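{- Let $\Gamma$ be a metrized graph with vertex set $V(\Gamma)$ and edge set $E(\Gamma)$, with resistance function $r(x,y)$, canonical measure $\mu_{can}$, tau constant $\tau(\Gamma)$ and Arakelov-Green function $g_{\mu_{can}}(x,y)$. Suppose $e_i \in E(\Gamma)$ is an edge of length $L_i$ with end points $p_i$ and $q_i$, and $e_j \in E(\Gamma)$ is an edge of length $L_j$ with end points $p_j$ and $q_j$. Let $x$ and $y$ belong to $e_i$ and $e_j$, respectively. (On the right-hand sides below, $x$ and $y$ denote the real parameters of the corresponding points.) (1) If both $x$ and $y$ are on the same edge and that edge is a bridge, then $$g_{\mu_{can}}(x,y)= \tau(\Gamma)- \frac{1}{2}|x-y|.$$ (2) If $e_i$ and $e_j$ are both bridges and are distinct edges, then $$g_{\mu_{can}}(x,y)=\begin{cases} \tau(\Gamma) -\frac{1}{2}\big(x+y+r(p_i,p_j)\big), & \text{if } p_i \text{ and } p_j \text{ are between } x \text{ and } y, \\ \tau(\Gamma)- \frac{1}{2}\big(x+L_j-y+r(p_i,q_j) \big), & \text{if } p_i \text{ and } q_j \text{ are between } x \text{ and } y,\\ \tau(\Gamma)- \frac{1}{2}\big(L_i-x+y+r(p_j,q_i)\big), & \text{if } p_j \text{ and } q_i \text{ are between } x \text{ and } y,\\ \tau(\Gamma)- \frac{1}{2}\big(L_i-x+L_j-y+r(q_i,q_j)\big), & \text{if } q_i \text{ and } q_j \text{ are between } x \text{ and } y. \end{cases}$$ (3) Suppose only $e_i$ is a bridge, i.e. $e_i$ is a bridge and $e_j$ is not (the case in which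 only $e_j$ is a bridge is the same after exchanging roles). If $y$ is on the side of $p_i$, then $$g_{\mu_{can}}(x,y) =\tau(\Gamma)+y^2\, \frac{L_j - r(p_j,q_j)}{2L_j^2}-y\, \frac{L_j-r(p_j,q_j)+r(p_i,q_j)-r(p_i,p_j)}{2L_j} -\frac{1}{2}\big(x +r(p_i,p_j) \big).$$ If $y$ is on the side of $q_i$, then $$g_{\mu_{can}}(x,y) =\tau(\Gamma) +y^2\, \frac{L_j - r(p_j,q_j)}{2L_j^2}-y\, \frac{L_j-r(p_j,q_j)+r(q_i,q_j)-r(q_i,p_j)}{2L_j} -\frac{1}{2}\big(L_i-x +r(q_i,p_j) \big).$$
   Context: A metrized graph $\Gamma$ is a finite connected graph whose edges are equipped with a distinguished parametrization by line segments (multiple edges and self-loops are allowed). The valence of $p\in\Gamma$ is the number of directions emanating from $p$. A vertex set $V(\Gamma)$ is a finite non-empty subset of $\Gamma$ containing every point of valence $\neq 2$ (additional points of valence 2 may be included). The set $E(\Gamma)$ of edges is the set of closed line segments with end points in $V(\Gamma)$ into which $V(\Gamma)$ divides $\Gamma$; the length of $e_i$ is a positive real number $L_i$. An edge $e_i$ is a bridge if $\Gamma-e_i$, the graph obtained by deleting the interior of $e_i$, is disconnected. Sides: if $e_i$ is a bridge, then $\Gamma-e_i$ has two components, one containing $p_i$ and one containing $q_i$; a point is "on the side of $p_i$" (resp. "of $q_i$") if it lies in the component of $\Gamma-e_i$ containing $p_i$ (resp. $q_i$). If $e_i\ne e_j$ are both bridges, and $a\in\{p_i,q_i\}$, $b\in\{p_j,q_j\}$,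 then "$a$ and $b$ are between $x$ and $y$" (for $x\in e_i$, $y\in e_j$) means that $e_j$ lies in the component of $\Gamma-e_i$ containing $a$ and $e_i$ lies in the component of $\Gamma-e_j$ containing $b$. Parametrization convention: an edge $e_i$ of length $L_i$ with end points $p_i,q_i$ is identified with $[0,L_i]$ so that $p_i$ corresponds to $0$ and $q_i$ to $L_i$ (likewise for $e_j$). A point of an edge and the corresponding real number are denoted by the same letter: in the arguments of $r$ and $g_{\mu_{can}}$ the letters denote points of $\Gamma$, elsewhere in formulas they denote the real parameters. Voltage and resistance functions: view $\Gamma$ as a resistive electric circuit in which each edge has resistance equal to its length. For $x,y,z\in\Gamma$, $j_z(x,y)$ is the voltage difference between $x$ and $z$ when unit current enters at $y$ and exits at $z$ (with reference voltage $0$ at $z$). Equivalently, for fixed $y,z$, $x\mapsto j_z(x,y)$ is the unique continuous piecewise affine function $f$ on $\Gamma$ with $f(z)=0$ and $\Delta f=\delta_y-\delta_z$, where $\Delta f=-\sum_{p}\sigma_p(f)\,\delta_p$ and $\sigma_p(f)$ is the sum of the slopes of $f$ in all directions emanating from $p$. The resistance function is $r(x,y)=j_y(x,x)$, the effective resistance between $x$ and $y$. Canonical measure, tau constant, Arakelov-Green function: for a real-valued signed Borel measure $\mu$ on $\Gamma$ with $\mu(\Gamma)=1$ and $|\mu|(\Gamma)<\infty$, put $j_\mu(x,y)=\int_\Gamma j_z(x,y)\,d\mu(z)$. There is a unique such measure $\mu=\mu_{can}$ for which $j_\mu(x,x)$ is constant on $\Gamma$; it is called the canonical measure. The tau constant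 is $\tau(\Gamma)=\frac12 j_{\mu_{can}}(x,x)$ (for any $x\in\Gamma$). The Arakelov-Green function associated to $\mu$ is $$g_\mu(x,y)=\int_\Gamma j_z(x,y)\,d\mu(z)-\int_{\Gamma^3} j_z(x,y)\,d\mu(z)\,d\mu(x)\,d\mu(y).$$ -}

module Defs where

open import Level using (0ℓ)
open import Algebra.Bundles using (CommutativeRing)
import Algebra.Construct.NaturalChoice.Max as Max
import Algebra.Properties.Monoid.Sum as Sum
open import Axiom.ExcludedMiddle using (ExcludedMiddle)
open import Data.Bool.Base using (if_then_else_)
open import Data.Fin.Base using (Fin; toℕ)
open import Data.Fin.Properties using (_≟_)
open import Data.Nat.Base as ℕ using (ℕ; zero; suc)
open import Data.Product.Base using (∃; _×_; _,_)
open import Data.Sum.Base using (_⊎_)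
open import Relation.Binary.Bundles using (TotalOrder)
open import Relation.Binary.Core using (Rel)
open import Relation.Binary.Construct.Closure.Equivalence using (EqClosure)
import Relation.Binary.Construct.NonStrictToStrict as Strict
open import Relation.Binary.PropositionalEquality using (_≡_; _≢_)
open import Relation.Binary.Structures using (IsTotalOrder)
open import Relation.Nullary using (¬_)
open import Relation.Nullary.Decidable using (does)
open import Relation.Unary using (Pred; _≐_; _∩_; ∁; Empty; U; ⋃)

-- The real numbers, given by their second-order axioms: a Dedekind-complete
-- totally ordered field.  As usual for a total inverse, 0# ⁻¹ is left
-- unspecified.
record RealField : Set₁ where
  infix  8 _⁻¹
  infixl 7 _/_
  infix  4 _≤_
  field
    commutativeRing : CommutativeRing 0ℓ 0ℓ
  open CommutativeRing commutativeRing public renaming (Carrier to ℝ)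
  field
    _≤_          : Rel ℝ 0ℓ
    isTotalOrder : IsTotalOrder _≈_ _≤_
    0≉1          : 0# ≉ 1#
    +-monoˡ-≤    : ∀ z {x y} → x ≤ y → x + z ≤ y + z
    *-nonNeg     : ∀ {x y} → 0# ≤ x → 0# ≤ y → 0# ≤ x * y
    _⁻¹          : ℝ → ℝ
    ⁻¹-cong      : ∀ {x y} → x ≈ y → x ⁻¹ ≈ y ⁻¹
    *-inverseʳ   : ∀ {x} → x ≉ 0# → x * x ⁻¹ ≈ 1#
    supremum     : (S : Pred ℝ 0ℓ) → ∃ S → (∃ λ b → ∀ x → S x → x ≤ b) →
                   ∃ λ s → (∀ x → S x → x ≤ s) ×
                           (∀ b → (∀ x → S x → x ≤ b) → s ≤ b)

  open Strict _≈_ _≤_ public using (_<_)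

  totalOrder : TotalOrder 0ℓ 0ℓ 0ℓ
  totalOrder = record { isTotalOrder = isTotalOrder }

  open Max totalOrder public using (_⊔_)
  open Sum +-monoid public using (sum; sum-syntax)

  _/_ : ℝ → ℝ → ℝ
  x / y = x * y ⁻¹

  2# ½ : ℝ
  2# = 1# + 1#
  ½  = 1# / 2#

  ∣_∣ : ℝ → ℝ
  ∣ x ∣ = x ⊔ (- x)

data Link {m n} (p q : Fin m → Fin n) (A : Pred (Fin m) 0ℓ) :
          Rel (Fin n) 0ℓ where
  link : ∀ e → A e → Link p q A (p e) (q e)

module _ (R : RealField) where
  open RealField R

  record Segment (L : ℝ) : Set where
    constructor segment
    field
      val   : ℝ
      0≤val : 0# ≤ val
      val≤L : val ≤ L

  -- A metrized graph together with a vertex set: vertices and edges are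
  -- numbered, and edge e, of length `len e`, runs from p e (parameter 0) to
  -- q e (parameter len e).  Loops and multiple edges are allowed.
  record MetrizedGraph : Set where
    field
      #V #E : ℕ
      p q   : Fin #E → Fin #V
      len   : Fin #E → ℝ
      0<len : ∀ e → 0# < len e

    -- u and v are joined by a path all of whose edges satisfy A.
    Joined : Pred (Fin #E) 0ℓ → Rel (Fin #V) 0ℓ
    Joined A = EqClosure (Link p q A)

    field
      nonEmpty  : #V ≢ 0
      connected : ∀ u v → Joined U u v

open Segment public using (val)

module OnGraph (lem : ∀ {ℓ} → ExcludedMiddle ℓ) (R : RealField)
               (Γ : MetrizedGraph R) where
  open RealField R
  open MetrizedGraph Γ public

  ----------------------------------------------------------------------
  -- Points and topology

  -- The points of Γ are the elements of the disjoint union of the vertex set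
  -- and the closed segments [0, len e], modulo gluing end points to vertices.
  data Point : Set where
    vertex : Fin #V → Point
    on     : (e : Fin #E) → Segment R (len e) → Point

  data Glue : Rel Point 0ℓ where
    same  : ∀ e {s t} → val s ≈ val t → Glue (on e s) (on e t)
    start : ∀ e {t} → val t ≈ 0# → Glue (on e t) (vertex (p e))
    end   : ∀ e {t} → val t ≈ len e → Glue (on e t) (vertex (q e))

  infix 4 _≈ₚ_
  _≈ₚ_ : Rel Point 0ℓ
  _≈ₚ_ = EqClosure Glue

  -- The quotient topology.
  IsOpen : Pred Point 0ℓ → Set
  IsOpen U =
    (∀ {x y} → x ≈ₚ y → U x → U y) ×
    (∀ e t → U (on e t) →
      ∃ λ ε → 0# < ε × (∀ s → ∣ val s - val t ∣ < ε → U (on e s)))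

  -- Preimages of bounded open intervals are open.
  Continuous : (Point → ℝ) → Set
  Continuous f = ∀ a b → IsOpen (λ x → a < f x × f x < b)

  ----------------------------------------------------------------------
  -- Bridges and sides

  Joined-minus : Fin #E → Rel (Fin #V) 0ℓ
  Joined-minus e = Joined (λ e′ → e′ ≢ e)

  IsBridge : Fin #E → Set
  IsBridge e = ¬ (∀ u v → Joined-minus e u v)

  -- The point x lies in the component of Γ - e containing the vertex a.
  InComponent : Fin #E → Fin #V → Pred Point 0ℓ
  InComponent e a x =
    (∃ λ v → x ≈ₚ vertex v × Joined-minus e a v) ⊎
    (∃ λ e′ → e′ ≢ e × (∃ λ t → x ≈ₚ on e′ t) × Joined-minus e a (p e′))

  -- For an end point a of eᵢ and an end point b of eⱼ: a and b are between
  -- the points of eᵢ and the points of eⱼ.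
  Between : (eᵢ : Fin #E) → Fin #V → (eⱼ : Fin #E) → Fin #V → Set
  Between eᵢ a eⱼ b =
    (∀ t → InComponent eᵢ a (on eⱼ t)) × (∀ t → InComponent eⱼ b (on eᵢ t))

  ----------------------------------------------------------------------
  -- Piecewise affine functions and the Laplacian

  -- Each [0, len e] splits into finitely many closed subintervals
  -- [b k , b (suc k)] on which f is affine.
  PiecewiseAffine : (Point → ℝ) → Set
  PiecewiseAffine f = ∀ e →
    ∃ λ (n : ℕ) → ∃ λ (b : ℕ → ℝ) →
      b 0 ≈ 0# × b n ≈ len e ×
      (∀ k → k ℕ.< n →
        b k ≤ b (suc k) ×
        (∃ λ m → ∃ λ c → ∀ t → b k ≤ val t → val t ≤ b (suc k) →
          f (on e t) ≈ m * val t + c))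

  -- s is the slope of f at the point of e with parameter t in the direction of
  -- increasing, respectively decreasing, parameter.
  Slope⁺ Slope⁻ : (Point → ℝ) → (e : Fin #E) → Segment R (len e) → ℝ → Set
  Slope⁺ f e t s = ∃ λ ε → 0# < ε × val t + ε ≤ len e ×
    (∀ u → val t ≤ val u → val u ≤ val t + ε →
      f (on e u) ≈ f (on e t) + s * (val u - val t))
  Slope⁻ f e t s = ∃ λ ε → 0# < ε × 0# ≤ val t - ε ×
    (∀ u → val t - ε ≤ val u → val u ≤ val t →
      f (on e u) ≈ f (on e t) + s * (val t - val u))

  -- SlopeSum f x σ says that σ = σₓ(f).  A loop contributes two directions at
  -- its vertex.
  data SlopeSum (f : Point → ℝ) (x : Point) : ℝ → Set where
    at-vertex : ∀ v → x ≈ₚ vertex v → (s⁺ s⁻ : Fin #E → ℝ) →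
      (∀ e t → val t ≈ 0# → Slope⁺ f e t (s⁺ e)) →
      (∀ e t → val t ≈ len e → Slope⁻ f e t (s⁻ e)) →
      SlopeSum f x (∑[ e < #E ] ((if does (p e ≟ v) then s⁺ e else 0#) +
                                 (if does (q e ≟ v) then s⁻ e else 0#)))
    at-interior : ∀ e t → x ≈ₚ on e t → 0# < val t → val t < len e →
      ∀ {s⁺ s⁻} → Slope⁺ f e t s⁺ → Slope⁻ f e t s⁻ → SlopeSum f x (s⁺ + s⁻)

  -- The mass of the Dirac measure at y on the point x.
  δ : Point → Point → ℝ
  δ y x = if does (lem {P = x ≈ₚ y}) then 1# else 0#

  -- Δ f = h, where the purely atomic measures Δ f and h are given by their
  -- masses at points.
  HasLaplacian : (Point → ℝ) → (Point → ℝ) → Set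
  HasLaplacian f h = ∀ x → ∃ λ σ → SlopeSum f x σ × - σ ≈ h x

  ----------------------------------------------------------------------
  -- Voltage and resistance functions; `j z x y` stands for j_z(x,y)

  record IsVoltage (j : Point → Point → Point → ℝ) : Set where
    field
      cong            : ∀ z y {x x′} → x ≈ₚ x′ → j z x y ≈ j z x′ y
      continuous      : ∀ z y → Continuous (λ x → j z x y)
      piecewiseAffine : ∀ z y → PiecewiseAffine (λ x → j z x y)
      grounded        : ∀ z y → j z z y ≈ 0#
      laplacian       : ∀ z y → HasLaplacian (λ x → j z x y)
                                             (λ x → δ y x - δ z x)

  resistance : (Point → Point → Point → ℝ) → Point → Point → ℝ
  resistance j x y = j y x x

  ----------------------------------------------------------------------
  -- Signed Borel measures and integration

  data Borel : Pred Point 0ℓ → Set₁ where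
    isOpen     : ∀ {S} → IsOpen S → Borel S
    complement : ∀ {S} → Borel S → Borel (∁ S)
    union      : ∀ {S : ℕ → Pred Point 0ℓ} → (∀ n → Borel (S n)) →
                 Borel (⋃ ℕ S)
    resp       : ∀ {S T} → S ≐ T → Borel S → Borel T

  ConvergesTo : (ℕ → ℝ) → ℝ → Set
  ConvergesTo a l =
    ∀ ε → 0# < ε → ∃ λ N → ∀ n → N ℕ.≤ n → ∣ a n - l ∣ < ε

  record SignedMeasure : Set₁ where
    field
      μ          : ∀ {S} → Borel S → ℝ
      μ-cong     : ∀ {S T} → S ≐ T → (B : Borel S) (C : Borel T) → μ B ≈ μ C
      σ-additive : ∀ {S : ℕ → Pred Point 0ℓ} (B : ∀ n → Borel (S n)) →
                   (∀ m n → m ≢ n → Empty (S m ∩ S n)) →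
                   ConvergesTo (λ n → ∑[ k < n ] μ (B (toℕ k))) (μ (union B))

  -- A finite Borel partition of Γ, as a measurable map to a finite set.
  record Partition : Set₁ where
    field
      {size}     : ℕ
      cell       : Point → Fin size
      measurable : ∀ k → Borel (λ x → cell x ≡ k)

  module _ (M : SignedMeasure) where
    open SignedMeasure M

    HasTotalMass : ℝ → Set₁
    HasTotalMass m = (B : Borel U) → μ B ≈ m

    FiniteVariation : Set₁
    FiniteVariation = ∃ λ b → (P : Partition) →
      let open Partition P in ∑[ k < size ] ∣ μ (measurable k) ∣ ≤ b

    -- The integral of a bounded measurable function f, as the limit of the
    -- integrals of simple functions (x ↦ c (cell x)) converging uniformly to
    -- f; for a measure of finite variation it is the Lebesgue integral.
    HasIntegral : (Point → ℝ) → ℝ → Set₁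
    HasIntegral f I = ∀ ε → 0# < ε →
      ∃ λ (P : Partition) → let open Partition P in
        ∃ λ (c : Fin size → ℝ) →
          (∀ x → ∣ f x - c (cell x) ∣ ≤ ε) ×
          ∣ (∑[ k < size ] (c k * μ (measurable k))) - I ∣ ≤ ε

  ----------------------------------------------------------------------
  -- Canonical measure, tau constant and Arakelov–Green function

  module _ (j : Point → Point → Point → ℝ) (μ : SignedMeasure) where

    record IsCanonical : Set₁ where
      field
        totalMass       : HasTotalMass μ 1#
        finiteVariation : FiniteVariation μ
        constant        : ∃ λ c → ∀ x → HasIntegral μ (λ z → j z x x) c

    IsTau : ℝ → Set₁
    IsTau τ = ∃ λ c → (∀ x → HasIntegral μ (λ z → j z x x) c) × τ ≈ ½ * c

    -- g(x,y) = ∫ j_z(x,y) dμ(z) - ∫∫∫ j_z(x,y) dμ(z) dμ(x) dμ(y).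
    record IsGreen (g : Point → Point → ℝ) : Set₁ where
      field
        jμ     : Point → Point → ℝ
        inner  : ∀ x y → HasIntegral μ (λ z → j z x y) (jμ x y)
        k      : Point → ℝ
        middle : ∀ y → HasIntegral μ (λ x → jμ x y) (k y)
        C      : ℝ
        outer  : HasIntegral μ k C
        green  : ∀ x y → g x y ≈ jμ x y - C

{-# OPTIONS --safe #-}
module Submission where

-- Polarising the resistance, j_z(x,y) = ½ (r(x,z) + r(y,z) - r(x,y)), and integrating against
-- the canonical measure, for which ∫ r(x,z) dμ(z) is the constant 2τ, gives
-- g(x,y) = τ - ½ r(x,y); the theorem thus reduces to computing resistances.
--
-- Everything about voltages follows from uniqueness: a function with zero Laplacian is affine on
-- every edge and has zero energy, hence is constant.  For y at the parameter t of an edge e of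
-- length L, uniqueness gives j_z(·,y) = (1 - t/L) j_z(·,p) + (t/L) j_z(·,q) + (tent on e), with z
-- a vertex.  Symmetry of j_z thereby reduces to vertices, where it is the symmetry of the
-- energy pairing, and r(a,y) becomes an explicit quadratic polynomial in t.  For a bridge e,
-- uniqueness identifies j_p(·,q) with the function that is 0 on the side of p, L on the side
-- of q and the parameter on e, so that resistances add up along bridges.

open import Defs
open import Level using (0ℓ)
open import Algebra.Solver.Ring.AlmostCommutativeRing
  using (fromCommutativeRing; _-Raw-AlmostCommutative⟶_)
import Algebra.Construct.NaturalChoice.Max as Max
import Algebra.Construct.NaturalChoice.Min as Min
import Algebra.Properties.Ring as RingProperties
import Algebra.Properties.Semiring.Mult.TCOptimised as Mult
import Algebra.Properties.Semiring.Sum as SemiringSum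
import Algebra.Solver.Ring as RingSolver
open import Axiom.ExcludedMiddle using (ExcludedMiddle)
open import Data.Bool.Base using (if_then_else_)
open import Data.Empty using (⊥)
open import Data.Fin.Base using (Fin; zero; suc; toℕ; combine; remQuot)
open import Data.Fin.Properties using (_≟_; combine-remQuot; remQuot-combine; toℕ<n; toℕ-injective)
open import Data.Integer.Base as ℤ using (ℤ; +_; -[1+_]; _⊖_; 0ℤ; 1ℤ)
import Data.Integer.Properties as ℤ
open import Data.Maybe.Base using (just; nothing)
open import Data.Nat.Base as ℕ using (ℕ; zero; suc)
import Data.Nat.Properties as ℕ
open import Data.Product.Base using (∃; ∃₂; _×_; _,_; proj₁; proj₂)
open import Data.Sum.Base using (_⊎_; inj₁; inj₂)
open import Function.Base using (_∘_)
open import Function.Bundles using (_⇔_; mk⇔; Equivalence)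
open import Function.Properties.Equivalence using (⇔-isEquivalence)
open import Relation.Binary.Bundles using (TotalOrder)
open import Relation.Binary.Construct.Closure.Equivalence using (gfold; return)
import Relation.Binary.Construct.Closure.Equivalence as EqC
import Relation.Binary.Construct.NonStrictToStrict as Strict
open import Relation.Binary.Definitions using (WeaklyDecidable)
open import Relation.Binary.PropositionalEquality using (_≡_; _≢_)
import Relation.Binary.PropositionalEquality as ≡
import Relation.Binary.Reasoning.Setoid as SetoidReasoning
open import Relation.Nullary using (¬_; Dec; yes; no; contradiction)
open import Relation.Nullary.Decidable using (does)
open import Relation.Unary using (Pred; _≐_; _∩_; _∪_; ∁; Empty; U; ⋃)

-- Voltages and integrals are known only through their specifications. A slope holds on an interval
-- whose length depends on the point, so that affinity on a whole edge takes a supremum argument. An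
-- integral is a relation: it asks for approximating simple functions, and only the finite variation
-- of the measure makes its value unique. Beyond uniqueness, linearity and constants suffice,
-- because after polarisation the variable of integration occurs only in terms whose integral is
-- given. All voltages are referred to one kernel k(x,y) = j_b(x,y), grounded at a fixed vertex b.
-- Then r(x,y) = k(x,x) + k(y,y) - 2k(x,y), and polarisation is algebra plus the symmetry of k. At
-- the fraction l = t/L of an edge, k(y,y) interpolates the end values twice and gains the peak L
-- l(1-l) of the tent. Hence r(a,y) exceeds the interpolation of r(a,p) and r(a,q) by l(1-l)(L -
-- r(p,q)), the source of the quadratic term in (3). On a bridge r(p,q) = L, so the excess vanishes
-- and (1) and (2) are linear in the parameters.

module IntegerCoefficients (R : RealField) where
  open RealField R hiding (zero)
  open RingProperties ring
    using (-‿distribˡ-*; -‿distribʳ-*; -‿+-comm; -‿involutive; -0#≈0#)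
  open Mult semiring using (×-homo-+; ×1-homo-*; 1+×) renaming (_×_ to _·_)
  open SetoidReasoning setoid

  -- The ring solver has to compare coefficients by computation. Equality in `ℝ` is decided only by
  -- `lem`, which does not compute, so the coefficients are integers.
  ⟦_⟧ : ℤ → ℝ
  ⟦ + n ⟧      = n · 1#
  ⟦ -[1+ n ] ⟧ = - (suc n · 1#)

  private
    cancel-1 : ∀ a b → (1# + a) - (1# + b) ≈ a - b
    cancel-1 a b = begin
      (1# + a) + - (1# + b)       ≈⟨ +-congˡ (-‿+-comm 1# b) ⟨
      (1# + a) + (- 1# + - b)     ≈⟨ +-assoc (1# + a) (- 1#) (- b) ⟨
      ((1# + a) + - 1#) + - b     ≈⟨ +-congʳ (+-congʳ (+-comm 1# a)) ⟩
      ((a + 1#) + - 1#) + - b     ≈⟨ +-congʳ (+-assoc a 1# (- 1#)) ⟩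
      (a + (1# + - 1#)) + - b     ≈⟨ +-congʳ (+-congˡ (-‿inverseʳ 1#)) ⟩
      (a + 0#) + - b              ≈⟨ +-congʳ (+-identityʳ a) ⟩
      a + - b                     ∎

  ⊖-homo : ∀ m n → ⟦ m ⊖ n ⟧ ≈ m · 1# - n · 1#
  ⊖-homo m zero = begin
    m · 1#          ≈⟨ +-identityʳ (m · 1#) ⟨
    m · 1# + 0#     ≈⟨ +-congˡ -0#≈0# ⟨
    m · 1# + - 0#   ∎
  ⊖-homo zero (suc n) = sym (+-identityˡ _)
  ⊖-homo (suc m) (suc n) = begin
    ⟦ suc m ⊖ suc n ⟧                ≡⟨ ≡.cong ⟦_⟧ (ℤ.[1+m]⊖[1+n]≡m⊖n m n) ⟩
    ⟦ m ⊖ n ⟧                        ≈⟨ ⊖-homo m n ⟩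
    m · 1# - n · 1#                  ≈⟨ cancel-1 (m · 1#) (n · 1#) ⟨
    (1# + m · 1#) - (1# + n · 1#)    ≈⟨ +-cong (1+× m 1#) (-‿cong (1+× n 1#)) ⟨
    suc m · 1# - suc n · 1#          ∎

  +-homo : ∀ a b → ⟦ a ℤ.+ b ⟧ ≈ ⟦ a ⟧ + ⟦ b ⟧
  +-homo (+ m)    (+ n)    = ×-homo-+ 1# m n
  +-homo (+ m)    -[1+ n ] = ⊖-homo m (suc n)
  +-homo -[1+ m ] (+ n)    = trans (⊖-homo n (suc m)) (+-comm _ _)
  +-homo -[1+ m ] -[1+ n ] = begin
    - (suc (suc (m ℕ.+ n)) · 1#)     ≡⟨ ≡.cong (λ k → - (suc k · 1#)) (ℕ.+-suc m n) ⟨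
    - ((suc m ℕ.+ suc n) · 1#)       ≈⟨ -‿cong (×-homo-+ 1# (suc m) (suc n)) ⟩
    - (suc m · 1# + suc n · 1#)      ≈⟨ -‿+-comm _ _ ⟨
    - (suc m · 1#) + - (suc n · 1#)  ∎

  -‿homo : ∀ a → ⟦ ℤ.- a ⟧ ≈ - ⟦ a ⟧
  -‿homo (+ zero)  = sym -0#≈0#
  -‿homo (+ suc n) = refl
  -‿homo -[1+ n ]  = sym (-‿involutive _)

  private
    *-homo⁺ : ∀ m b → ⟦ (+ m) ℤ.* b ⟧ ≈ (m · 1#) * ⟦ b ⟧
    *-homo⁺ m (+ n) = trans (reflexive (≡.cong ⟦_⟧ (≡.sym (ℤ.pos-* m n)))) (×1-homo-* m n)
    *-homo⁺ m -[1+ n ] = begin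
      ⟦ (+ m) ℤ.* -[1+ n ] ⟧          ≡⟨ ≡.cong ⟦_⟧ (ℤ.neg-distribʳ-* (+ m) (+ suc n)) ⟨
      ⟦ ℤ.- ((+ m) ℤ.* (+ suc n)) ⟧   ≈⟨ -‿homo ((+ m) ℤ.* (+ suc n)) ⟩
      - ⟦ (+ m) ℤ.* (+ suc n) ⟧       ≈⟨ -‿cong (*-homo⁺ m (+ suc n)) ⟩
      - ((m · 1#) * (suc n · 1#))     ≈⟨ -‿distribʳ-* _ _ ⟩
      (m · 1#) * - (suc n · 1#)       ∎

  *-homo : ∀ a b → ⟦ a ℤ.* b ⟧ ≈ ⟦ a ⟧ * ⟦ b ⟧
  *-homo (+ m)    b = *-homo⁺ m b
  *-homo -[1+ m ] b = begin
    ⟦ -[1+ m ] ℤ.* b ⟧           ≡⟨ ≡.cong ⟦_⟧ (ℤ.neg-distribˡ-* (+ suc m) b) ⟨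
    ⟦ ℤ.- ((+ suc m) ℤ.* b) ⟧    ≈⟨ -‿homo ((+ suc m) ℤ.* b) ⟩
    - ⟦ (+ suc m) ℤ.* b ⟧        ≈⟨ -‿cong (*-homo⁺ (suc m) b) ⟩
    - ((suc m · 1#) * ⟦ b ⟧)     ≈⟨ -‿distribˡ-* _ _ ⟩
    - (suc m · 1#) * ⟦ b ⟧       ∎

  morphism : ℤ.+-*-rawRing -Raw-AlmostCommutative⟶ fromCommutativeRing commutativeRing
  morphism = record
    { ⟦_⟧ = ⟦_⟧ ; +-homo = +-homo ; *-homo = *-homo ; -‿homo = -‿homo
    -- The optimised multiples make `⟦ 0ℤ ⟧` and `⟦ 1ℤ ⟧` reduce to `0#` and `1#`, so solved
    -- equations mention these literally.
    ; 0-homo = refl ; 1-homo = refl }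

  coeff≟ : WeaklyDecidable (λ a b → ⟦ a ⟧ ≈ ⟦ b ⟧)
  coeff≟ a b with a ℤ.≟ b
  ... | yes ≡.refl = just refl
  ... | no  _      = nothing

  module Solver = RingSolver ℤ.+-*-rawRing (fromCommutativeRing commutativeRing) morphism coeff≟

-- Ordered field arithmetic, absolute values and finite sums.

module OrderedField (lem : ∀ {ℓ} → ExcludedMiddle ℓ) (R : RealField) where
  open RealField R hiding (zero)
  open IntegerCoefficients R using (module Solver)
  open Solver using (solve; _:+_; _:-_; _:*_; :-_; _:=_) public
  open TotalOrder totalOrder public
    using (total; antisym)
    renaming ( refl to ≤-refl; trans to ≤-trans; reflexive to ≤-reflexive
             ; ≤-respˡ-≈ to ≤-respˡ; ≤-respʳ-≈ to ≤-respʳ)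
  open RingProperties ring public using (-0#≈0#)
  module R-sum = SemiringSum semiring
  open SetoidReasoning setoid

  :0 :1 : ∀ {n} → Solver.Polynomial n
  :0 = Solver.con 0ℤ
  :1 = Solver.con 1ℤ

  ≈-dec : ∀ x y → Dec (x ≈ y)
  ≈-dec x y = lem

  ≤-dec : ∀ x y → Dec (x ≤ y)
  ≤-dec x y = lem

  <⇒≤ : ∀ {x y} → x < y → x ≤ y
  <⇒≤ = proj₁

  ≰⇒> : ∀ {x y} → ¬ x ≤ y → y < x
  ≰⇒> = Strict.≰⇒> _≈_ _≤_ sym ≤-reflexive total

  <⇒≱ : ∀ {x y} → x < y → ¬ y ≤ x
  <⇒≱ = Strict.<⇒≱ _≈_ _≤_ antisym

  <-≤-trans : ∀ {x y z} → x < y → y ≤ z → x < z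
  <-≤-trans = Strict.<-≤-trans _≈_ _≤_ sym ≤-trans antisym ≤-respʳ

  ≤-<-trans : ∀ {x y z} → x ≤ y → y < z → x < z
  ≤-<-trans = Strict.≤-<-trans _≈_ _≤_ ≤-trans antisym ≤-respˡ

  0≤y-x : ∀ {x y} → x ≤ y → 0# ≤ y - x
  0≤y-x {x} x≤y = ≤-respˡ (-‿inverseʳ x) (+-monoˡ-≤ (- x) x≤y)

  ≤-by : ∀ {x y d} → 0# ≤ d → y ≈ x + d → x ≤ y
  ≤-by {x} {y} {d} 0≤d e =
    ≤-respˡ (+-identityˡ x) (≤-respʳ (trans (+-comm d x) (sym e)) (+-monoˡ-≤ x 0≤d))

  +-mono-≤ : ∀ {a b c d} → a ≤ b → c ≤ d → a + c ≤ b + d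
  +-mono-≤ {a} {b} {c} {d} a≤b c≤d =
    ≤-trans (+-monoˡ-≤ c a≤b) (≤-respˡ (+-comm c b) (≤-respʳ (+-comm d b) (+-monoˡ-≤ b c≤d)))

  +-nonNeg : ∀ {x y} → 0# ≤ x → 0# ≤ y → 0# ≤ x + y
  +-nonNeg a b = ≤-respˡ (+-identityˡ 0#) (+-mono-≤ a b)

  *-monoˡ-≤ : ∀ {a x y} → 0# ≤ a → x ≤ y → a * x ≤ a * y
  *-monoˡ-≤ {a} {x} {y} 0≤a x≤y = ≤-by (*-nonNeg 0≤a (0≤y-x x≤y))
    (solve 3 (λ a x y → a :* y := a :* x :+ a :* (y :- x)) refl a x y)

  -‿anti-≤ : ∀ {x y} → x ≤ y → - y ≤ - x
  -‿anti-≤ {x} {y} x≤y = ≤-by (0≤y-x x≤y)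
    (solve 2 (λ x y → :- x := :- y :+ (y :- x)) refl x y)

  0<⇒≉0 : ∀ {x} → 0# < x → x ≉ 0#
  0<⇒≉0 (_ , ne) e = ne (sym e)

  0<y-x : ∀ {x y} → x < y → 0# < y - x
  0<y-x {x} {y} (x≤y , x≉y) = 0≤y-x x≤y , λ e → x≉y
    (trans (trans (sym (+-identityʳ x)) (+-congˡ e))
           (solve 2 (λ x y → x :+ (y :- x) := y) refl x y))

  0<y-x⁻¹ : ∀ {x y} → 0# < y - x → x < y
  0<y-x⁻¹ {x} {y} (h , ne) =
    ≤-by h (solve 2 (λ x y → y := x :+ (y :- x)) refl x y) ,
    λ e → ne (trans (sym (-‿inverseʳ x)) (+-congʳ e))

  *-zeroˡ-cancel : ∀ {x y} → x ≉ 0# → x * y ≈ 0# → y ≈ 0#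
  *-zeroˡ-cancel {x} {y} x≉0 e = begin
    y                 ≈⟨ *-identityˡ y ⟨
    1# * y            ≈⟨ *-congʳ (*-inverseʳ x≉0) ⟨
    (x * x ⁻¹) * y    ≈⟨ solve 3 (λ x i y → (x :* i) :* y := i :* (x :* y)) refl x (x ⁻¹) y ⟩
    x ⁻¹ * (x * y)    ≈⟨ *-congˡ e ⟩
    x ⁻¹ * 0#         ≈⟨ zeroʳ _ ⟩
    0#                ∎

  x-y≈0⇒x≈y : ∀ {x y} → x - y ≈ 0# → x ≈ y
  x-y≈0⇒x≈y {x} {y} e = begin
    x             ≈⟨ solve 2 (λ x y → x := (x :- y) :+ y) refl x y ⟩
    (x - y) + y   ≈⟨ +-congʳ e ⟩
    0# + y        ≈⟨ +-identityˡ y ⟩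
    y             ∎

  x≈y⇒x-y≈0 : ∀ {x y} → x ≈ y → x - y ≈ 0#
  x≈y⇒x-y≈0 {x} {y} e = trans (+-congʳ e) (-‿inverseʳ y)

  *-cancelˡ : ∀ {a x y} → a ≉ 0# → a * x ≈ a * y → x ≈ y
  *-cancelˡ {a} {x} {y} a≉0 e = x-y≈0⇒x≈y (*-zeroˡ-cancel a≉0 (trans
    (solve 3 (λ a x y → a :* (x :- y) := a :* x :- a :* y) refl a x y) (x≈y⇒x-y≈0 e)))

  *-pos : ∀ {x y} → 0# < x → 0# < y → 0# < x * y
  *-pos x>0 y>0 = *-nonNeg (<⇒≤ x>0) (<⇒≤ y>0) ,
    λ e → 0<⇒≉0 y>0 (*-zeroˡ-cancel (0<⇒≉0 x>0) (sym e))

  +-pos : ∀ {x y} → 0# < x → 0# ≤ y → 0# < x + y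
  +-pos {x} {y} x>0 y≥0 = <-≤-trans x>0 (≤-by y≥0 refl)

  square-nonNeg : ∀ x → 0# ≤ x * x
  square-nonNeg x with total 0# x
  ... | inj₁ h = *-nonNeg h h
  ... | inj₂ h = ≤-respʳ (solve 1 (λ x → (:- x) :* (:- x) := x :* x) refl x) (*-nonNeg h′ h′)
    where h′ = ≤-respˡ -0#≈0# (-‿anti-≤ h)

  0<1 : 0# < 1#
  0<1 = ≤-respʳ (*-identityˡ 1#) (square-nonNeg 1#) , 0≉1

  ⁻¹-pos : ∀ {x} → 0# < x → 0# < x ⁻¹
  ⁻¹-pos {x} x>0 with total 0# (x ⁻¹)
  ... | inj₁ h = h , λ e → 0≉1 (trans (sym (zeroʳ x)) (trans (*-congˡ e) (*-inverseʳ (0<⇒≉0 x>0))))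
  ... | inj₂ h = contradiction
    (≤-respˡ (*-inverseʳ (0<⇒≉0 x>0)) (≤-respʳ (zeroʳ x) (*-monoˡ-≤ (<⇒≤ x>0) h))) (<⇒≱ 0<1)
  0<2 : 0# < 2#
  0<2 = +-pos 0<1 (<⇒≤ 0<1)

  ½+½≈1 : ½ + ½ ≈ 1#
  ½+½≈1 = begin
    1# * 2# ⁻¹ + 1# * 2# ⁻¹   ≈⟨ solve 1 (λ i → :1 :* i :+ :1 :* i := (:1 :+ :1) :* i) refl (2# ⁻¹) ⟩
    2# * 2# ⁻¹                ≈⟨ *-inverseʳ (0<⇒≉0 0<2) ⟩
    1#                        ∎

  double-half : ∀ x → ½ * x + ½ * x ≈ x
  double-half x = trans (sym (distribʳ x ½ ½)) (trans (*-congʳ ½+½≈1) (*-identityˡ x))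

  halve : ∀ {x y} → x + x ≈ y → x ≈ ½ * y
  halve {x} {y} e = begin
    x                ≈⟨ double-half x ⟨
    ½ * x + ½ * x    ≈⟨ distribˡ ½ x x ⟨
    ½ * (x + x)      ≈⟨ *-congˡ e ⟩
    ½ * y            ∎

  halve-nonNeg : ∀ {x} → 0# ≤ x + x → 0# ≤ x
  halve-nonNeg {x} h with total 0# x
  ... | inj₁ 0≤x = 0≤x
  ... | inj₂ x≤0 = ≤-trans h (≤-respʳ (+-identityˡ x) (+-monoˡ-≤ x x≤0))

  ½-pos : ∀ {x} → 0# < x → 0# < ½ * x
  ½-pos {x} x>0 = halve-nonNeg (≤-respʳ (sym (double-half x)) (<⇒≤ x>0)) ,
    λ e → 0<⇒≉0 x>0 (trans (sym (double-half x)) (trans (+-cong (sym e) (sym e)) (+-identityˡ 0#)))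

  ≤-small⇒≤0 : ∀ {x} → (∀ ε → 0# < ε → x ≤ ε) → x ≤ 0#
  ≤-small⇒≤0 {x} h with ≤-dec x 0#
  ... | yes x≤0 = x≤0
  -- For `ε = ½ * x` the hypothesis gives `x ≤ ½ * x`, hence `½ * x ≤ 0#`.
  ... | no  x≰0 = contradiction (≤-by (0≤y-x (h (½ * x) (½-pos x>0))) eq) (<⇒≱ (½-pos x>0))
    where
    x>0 = ≰⇒> x≰0
    eq : 0# ≈ ½ * x + (½ * x - x)
    eq = sym (trans (solve 2 (λ a x → a :+ (a :- x) := (a :+ a) :- x) refl (½ * x) x)
                    (x≈y⇒x-y≈0 (double-half x)))

  open Max totalOrder
    using (⊔-cong; x≤x⊔y; x≤y⊔x; ⊔-lub) public

  ∣∣-cong : ∀ {x y} → x ≈ y → ∣ x ∣ ≈ ∣ y ∣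
  ∣∣-cong e = ⊔-cong e (-‿cong e)

  x≤∣x∣ : ∀ x → x ≤ ∣ x ∣
  x≤∣x∣ x = x≤x⊔y x (- x)

  -x≤∣x∣ : ∀ x → - x ≤ ∣ x ∣
  -x≤∣x∣ x = x≤y⊔x x (- x)

  ∣∣-≤ : ∀ {x a} → x ≤ a → - x ≤ a → ∣ x ∣ ≤ a
  ∣∣-≤ = ⊔-lub

  0≤∣x∣ : ∀ x → 0# ≤ ∣ x ∣
  0≤∣x∣ x = halve-nonNeg (≤-respˡ (-‿inverseʳ x) (+-mono-≤ (x≤∣x∣ x) (-x≤∣x∣ x)))

  ∣∣-+ : ∀ x y → ∣ x + y ∣ ≤ ∣ x ∣ + ∣ y ∣
  ∣∣-+ x y = ∣∣-≤ (+-mono-≤ (x≤∣x∣ x) (x≤∣x∣ y))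
    (≤-respˡ (solve 2 (λ x y → :- x :+ :- y := :- (x :+ y)) refl x y) (+-mono-≤ (-x≤∣x∣ x) (-x≤∣x∣ y)))

  ∣∣-neg : ∀ x → ∣ - x ∣ ≤ ∣ x ∣
  ∣∣-neg x = ∣∣-≤ (-x≤∣x∣ x) (≤-respˡ (solve 1 (λ x → x := :- (:- x)) refl x) (x≤∣x∣ x))

  ∣∣-nonNeg : ∀ {x} → 0# ≤ x → ∣ x ∣ ≈ x
  ∣∣-nonNeg {x} h = antisym (∣∣-≤ ≤-refl (≤-trans (≤-respʳ -0#≈0# (-‿anti-≤ h)) h)) (x≤∣x∣ x)

  ∣∣-swap : ∀ x y → ∣ x - y ∣ ≈ ∣ y - x ∣
  ∣∣-swap x y = antisym (half x y) (half y x)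
    where
    half : ∀ x y → ∣ x - y ∣ ≤ ∣ y - x ∣
    half x y = ≤-respˡ (∣∣-cong (solve 2 (λ x y → :- (y :- x) := x :- y) refl x y)) (∣∣-neg (y - x))

  -- From 0 ≤ (a - c)(∣m∣ + m) + (a + c)(∣m∣ - m) = 2 (a∣m∣ - c m), and the same for -c.
  ∣∣-*-≤ : ∀ {a c} m → ∣ c ∣ ≤ a → ∣ c * m ∣ ≤ a * ∣ m ∣
  ∣∣-*-≤ {a} {c} m c≤a = ∣∣-≤ (bound c≤a) (≤-respˡ (solve 2 (λ c m → :- c :* m := :- (c :* m)) refl c m)
      (bound (≤-trans (∣∣-neg c) c≤a)))
    where
    bound : ∀ {c} → ∣ c ∣ ≤ a → c * m ≤ a * ∣ m ∣
    bound {c} c≤a = ≤-by (halve-nonNeg (≤-respʳ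
        (solve 4 (λ a c n m → (a :- c) :* (n :+ m) :+ (a :- (:- c)) :* (n :- m) :=
                              (a :* n :- c :* m) :+ (a :* n :- c :* m)) refl a c ∣ m ∣ m)
        (+-nonNeg (*-nonNeg (0≤y-x (≤-trans (x≤∣x∣ c) c≤a))
                    (≤-respʳ (solve 2 (λ n m → n :- (:- m) := n :+ m) refl ∣ m ∣ m) (0≤y-x (-x≤∣x∣ m))))
                  (*-nonNeg (0≤y-x (≤-trans (-x≤∣x∣ c) c≤a)) (0≤y-x (x≤∣x∣ m))))))
      (solve 2 (λ x y → y := x :+ (y :- x)) refl (c * m) (a * ∣ m ∣))

  ∣∣≤small⇒≈0 : ∀ {x} → (∀ ε → 0# < ε → ∣ x ∣ ≤ ε) → x ≈ 0#
  ∣∣≤small⇒≈0 {x} h = antisym (≤-trans (x≤∣x∣ x) ∣x∣≤0)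
      (≤-by (≤-respʳ refl (≤-respˡ -0#≈0# (-‿anti-≤ (≤-trans (-x≤∣x∣ x) ∣x∣≤0))))
            (solve 1 (λ x → x := :0 :+ :- (:- x)) refl x))
    where ∣x∣≤0 = ≤-small⇒≤0 h

  sum-mono : ∀ {n} {f g : Fin n → ℝ} → (∀ k → f k ≤ g k) → sum f ≤ sum g
  sum-mono {zero}  h = ≤-refl
  sum-mono {suc n} h = +-mono-≤ (h zero) (sum-mono (h ∘ suc))

  ∣sum∣≤sum∣∣ : ∀ {n} (f : Fin n → ℝ) → ∣ sum f ∣ ≤ ∑[ k < n ] ∣ f k ∣
  ∣sum∣≤sum∣∣ {zero}  f = ≤-reflexive (∣∣-nonNeg ≤-refl)
  ∣sum∣≤sum∣∣ {suc n} f =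
    ≤-trans (∣∣-+ (f zero) (sum (f ∘ suc))) (+-mono-≤ ≤-refl (∣sum∣≤sum∣∣ (f ∘ suc)))

  sum-nonNeg : ∀ {n} {f : Fin n → ℝ} → (∀ k → 0# ≤ f k) → 0# ≤ sum f
  sum-nonNeg {zero}  h = ≤-refl
  sum-nonNeg {suc n} h = +-nonNeg (h zero) (sum-nonNeg (h ∘ suc))

  sum-nonNeg-zero : ∀ {n} {f : Fin n → ℝ} → (∀ k → 0# ≤ f k) → sum f ≈ 0# → ∀ k → f k ≈ 0#
  sum-nonNeg-zero {suc n} {f} h e zero =
    antisym (≤-trans (≤-by (sum-nonNeg (h ∘ suc)) refl) (≤-reflexive e)) (h zero)
  sum-nonNeg-zero {suc n} {f} h e (suc k) = sum-nonNeg-zero (h ∘ suc)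
    (antisym (≤-trans (≤-by (h zero) (+-comm _ _)) (≤-reflexive e)) (sum-nonNeg (h ∘ suc))) k

  sum-single : ∀ {n} (a : Fin n) (f : Fin n → ℝ) →
               ∑[ i < n ] (if does (a ≟ i) then f i else 0#) ≈ f a
  sum-single {suc n} zero    f = trans (+-congˡ (R-sum.sum-replicate-zero n)) (+-identityʳ _)
  sum-single {suc n} (suc a) f = trans (+-identityˡ _) (sum-single a (f ∘ suc))

  sum-zero : ∀ {n} {f : Fin n → ℝ} → (∀ k → f k ≈ 0#) → sum f ≈ 0#
  sum-zero {n} h = trans (R-sum.sum-cong-≋ h) (R-sum.sum-replicate-zero n)

  -- Equations x ≈ y certified by writing x - y as a combination of differences
  -- a - b of equations a ≈ b already known.
  lin₁ : ∀ {x y k a b} → a ≈ b → x - y ≈ k * (a - b) → x ≈ y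
  lin₁ a≈b e = x-y≈0⇒x≈y (trans e (trans (*-congˡ (x≈y⇒x-y≈0 a≈b)) (zeroʳ _)))

  lin₂ : ∀ {x y k a b k′ a′ b′} → a ≈ b → a′ ≈ b′ →
         x - y ≈ k * (a - b) + k′ * (a′ - b′) → x ≈ y
  lin₂ {y = y} {k = k} {a} {b} a≈b a′≈b′ e = lin₁ a′≈b′ (trans e (trans
    (+-congʳ (trans (*-congˡ (x≈y⇒x-y≈0 a≈b)) (zeroʳ _))) (+-identityˡ _)))

  lin₃ : ∀ {x y k a b k′ a′ b′ k″ a″ b″} → a ≈ b → a′ ≈ b′ → a″ ≈ b″ →
         x - y ≈ k * (a - b) + k′ * (a′ - b′) + k″ * (a″ - b″) → x ≈ y
  lin₃ {k = k} {a} {b} {k′} {a′} {b′} a≈b a′≈b′ a″≈b″ e = lin₁ a″≈b″ (trans e (trans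
    (+-congʳ (trans (+-cong (trans (*-congˡ (x≈y⇒x-y≈0 a≈b)) (zeroʳ _)) (trans (*-congˡ (x≈y⇒x-y≈0 a′≈b′)) (zeroʳ _)))
                    (+-identityˡ _))) (+-identityˡ _)))

-- Linearity and uniqueness of the integral.

module Integration (lem : ∀ {ℓ} → ExcludedMiddle ℓ) (R : RealField) (Γ : MetrizedGraph R)
                   (M : OnGraph.SignedMeasure lem R Γ) where
  open RealField R hiding (zero)
  open OnGraph lem R Γ
  open OrderedField lem R
  open SignedMeasure M
  open SetoidReasoning setoid

  ∅-borel : Borel (λ _ → ⊥)
  ∅-borel = isOpen ((λ _ ()) , λ _ _ ())

  U-borel : Borel U
  U-borel = isOpen ((λ _ _ → _) , λ _ _ _ → 1# , 0<1 , λ _ _ → _)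

  ∪-borel : ∀ {S T} → Borel S → Borel T → Borel (S ∪ T)
  ∪-borel {S} {T} B C = resp (to , from) (union pieces)
    where
    -- `Borel` provides countable unions, so `T` is repeated from index 1 on.
    family : ℕ → Pred Point 0ℓ
    family zero    = S
    family (suc _) = T
    pieces : ∀ n → Borel (family n)
    pieces zero    = B
    pieces (suc _) = C
    to : ∀ {x} → ⋃ ℕ family x → (S ∪ T) x
    to (zero  , s) = inj₁ s
    to (suc _ , t) = inj₂ t
    from : ∀ {x} → (S ∪ T) x → ⋃ ℕ family x
    from (inj₁ s) = 0 , s
    from (inj₂ t) = 1 , t

  ∩-borel : ∀ {S T} → Borel S → Borel T → Borel (S ∩ T)
  ∩-borel {S} {T} B C =
    resp (to , λ { (s , t) (inj₁ ¬s) → ¬s s ; (s , t) (inj₂ ¬t) → ¬t t })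
         (complement (∪-borel (complement B) (complement C)))
    where
    to : ∀ {x} → ∁ (∁ S ∪ ∁ T) x → (S ∩ T) x
    to {x} h with lem {P = S x} | lem {P = T x}
    ... | yes s | yes t = s , t
    ... | no ¬s | _     = contradiction (inj₁ ¬s) h
    ... | _     | no ¬t = contradiction (inj₂ ¬t) h

  -- An empty set is disjoint from itself, so σ-additivity applies to the constant sequence. Its
  -- partial sums converge, hence two consecutive ones, which differ by `μ B`, come arbitrarily
  -- close.
  μ-∅ : ∀ {S} (B : Borel S) → Empty S → μ B ≈ 0#
  μ-∅ {S} B S-empty = ∣∣≤small⇒≈0 small
    where
    l = μ (union λ (_ : ℕ) → B)
    small : ∀ ε → 0# < ε → ∣ μ B ∣ ≤ ε
    small ε ε>0 = ≤-trans (≤-reflexive (∣∣-cong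
          (solve 3 (λ m a l → m := ((m :+ a) :- l) :+ :- (a :- l)) refl (μ B) a l)))
        (≤-trans (∣∣-+ ((μ B + a) - l) (- (a - l)))
        (≤-trans (+-mono-≤ (<⇒≤ (close (suc N) (ℕ.n≤1+n N))) (≤-trans (∣∣-neg (a - l)) (<⇒≤ (close N ℕ.≤-refl))))
                 (≤-reflexive (double-half ε))))
      where
      limit = σ-additive (λ _ → B) (λ _ _ _ x (s , _) → S-empty x s) (½ * ε) (½-pos ε>0)
      N     = proj₁ limit
      close = proj₂ limit
      a     = ∑[ k < N ] μ B

  sum-extend : ∀ (f : ℕ → ℝ) N d → (∀ n → N ℕ.≤ n → f n ≈ 0#) →
               ∑[ k < N ℕ.+ d ] f (toℕ k) ≈ ∑[ k < N ] f (toℕ k)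
  sum-extend f zero    d h = sum-zero {d} (λ k → h (toℕ k) ℕ.z≤n)
  sum-extend f (suc N) d h = +-congˡ (sum-extend (f ∘ suc) N d (λ n N≤n → h (suc n) (ℕ.s≤s N≤n)))

  module _ (Q : Partition) where
    open Partition Q

    -- σ-additivity speaks of sequences over ℕ. The cells that `π` sends to `i` are therefore spread
    -- over `S n`, which is the cell with number `n` if that cell is sent to `i`, and empty
    -- otherwise. The partial sums are stationary from `size` on.
    finite-additive : ∀ {m} (π : Fin size → Fin m) i (B : Borel (λ x → π (cell x) ≡ i)) →
      μ B ≈ ∑[ k < size ] (if does (π k ≟ i) then μ (measurable k) else 0#)
    finite-additive π i B = sym (x-y≈0⇒x≈y (∣∣≤small⇒≈0 small))
      where
      S : ℕ → Pred Point 0ℓ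
      S n x = toℕ (cell x) ≡ n × π (cell x) ≡ i

      S-single : ∀ {k} → π k ≡ i → (λ x → cell x ≡ k) ≐ S (toℕ k)
      S-single πk≡i = (λ { ≡.refl → ≡.refl , πk≡i }) , λ (e , _) → toℕ-injective e

      C : ∀ n → Borel (S n)
      C n with lem {P = ∃ λ k → toℕ k ≡ n × π k ≡ i}
      ... | yes (k , ≡.refl , πk≡i) = resp (S-single πk≡i) (measurable k)
      ... | no none = resp ((λ ()) , λ {x} s → none (cell x , s)) ∅-borel

      μ-C : ∀ k → μ (C (toℕ k)) ≈ (if does (π k ≟ i) then μ (measurable k) else 0#)
      μ-C k with π k ≟ i
      ... | yes πk≡i = sym (μ-cong (S-single πk≡i) (measurable k) (C (toℕ k)))
      ... | no  πk≢i = μ-∅ (C (toℕ k)) λ x (e , πx≡i) →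
              πk≢i (≡.trans (≡.cong π (≡.sym (toℕ-injective e))) πx≡i)

      μ-C-large : ∀ n → size ℕ.≤ n → μ (C n) ≈ 0#
      μ-C-large n N≤n = μ-∅ (C n) λ x (e , _) →
        ℕ.<⇒≱ (toℕ<n (cell x)) (≡.subst (size ℕ.≤_) (≡.sym e) N≤n)

      small : ∀ ε → 0# < ε → ∣ _ - μ B ∣ ≤ ε
      small ε ε>0 = ≤-respˡ (∣∣-cong (+-cong
            (trans (sum-extend (λ n → μ (C n)) size N μ-C-large) (R-sum.sum-cong-≋ μ-C))
            (-‿cong (μ-cong ((λ (_ , _ , e) → e) , λ e → _ , ≡.refl , e) (union C) B))))
          -- The index `size ℕ.+ N` is past `size`, where the sum is complete, and past `N`, where
          -- it is close to the limit.
          (<⇒≤ (proj₂ limit (size ℕ.+ N) (ℕ.m≤n+m N size)))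
        where
        limit = σ-additive C (λ m n m≢n x ((a , _) , (b , _)) → m≢n (≡.trans (≡.sym a) b)) ε ε>0
        N     = proj₁ limit

  ∫simple : (P : Partition) → (Fin (Partition.size P) → ℝ) → ℝ
  ∫simple P c = ∑[ k < size ] (c k * μ (measurable k))
    where open Partition P

  -- Two simple functions on different partitions can be added only on a common refinement; this
  -- transfers their integrals to it. Each coarse cell is split into fine ones and the two sums are
  -- exchanged.
  ∫simple-refine : ∀ (P Q : Partition) (π : Fin (Partition.size Q) → Fin (Partition.size P)) →
    (∀ x → Partition.cell P x ≡ π (Partition.cell Q x)) →
    ∀ c → ∫simple P c ≈ ∫simple Q (c ∘ π)
  ∫simple-refine P Q π coarser c = begin
    ∑[ i < P.size ] (c i * μ (P.measurable i))
      ≈⟨ R-sum.sum-cong-≋ (λ i → trans (*-congˡ (trans (μ-cong same-cell (P.measurable i) (B i))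
            (finite-additive Q π i (B i)))) (R-sum.*-distribˡ-sum (c i) (term i))) ⟩
    ∑[ i < P.size ] ∑[ k < Q.size ] (c i * term i k)
      ≈⟨ R-sum.∑-comm (λ i k → c i * term i k) ⟩
    ∑[ k < Q.size ] ∑[ i < P.size ] (c i * term i k)
      ≈⟨ R-sum.sum-cong-≋ (λ k → trans (R-sum.sum-cong-≋ (λ i → push i k))
            (sum-single (π k) (λ i → c i * μ (Q.measurable k)))) ⟩
    ∑[ k < Q.size ] (c (π k) * μ (Q.measurable k)) ∎
    where
    module P = Partition P
    module Q = Partition Q
    term : Fin P.size → Fin Q.size → ℝ
    term i k = if does (π k ≟ i) then μ (Q.measurable k) else 0#
    same-cell : ∀ {i} → (λ x → P.cell x ≡ i) ≐ (λ x → π (Q.cell x) ≡ i)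
    same-cell = (λ {x} e → ≡.trans (≡.sym (coarser x)) e) , λ {x} e → ≡.trans (coarser x) e
    B : ∀ i → Borel (λ x → π (Q.cell x) ≡ i)
    B i = resp same-cell (P.measurable i)
    push : ∀ i k → c i * term i k ≈ (if does (π k ≟ i) then c i * μ (Q.measurable k) else 0#)
    push i k with π k ≟ i
    ... | yes _ = refl
    ... | no  _ = zeroʳ (c i)

  module _ (P Q : Partition) where
    private
      module P = Partition P
      module Q = Partition Q

    _⊓ₚ_ : Partition
    _⊓ₚ_ = record
      { cell       = λ x → combine (P.cell x) (Q.cell x)
      ; measurable = λ k → resp
          ( (λ { (a , b) → ≡.trans (≡.cong₂ combine a b) (combine-remQuot {P.size} Q.size k) })
          , λ {x} e → ≡.cong proj₁ (split x e) , ≡.cong proj₂ (split x e))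
          (∩-borel (P.measurable (proj₁ (remQuot {P.size} Q.size k))) (Q.measurable (proj₂ (remQuot {P.size} Q.size k))))
      }
      where
      split : ∀ x {k} → combine (P.cell x) (Q.cell x) ≡ k → (P.cell x , Q.cell x) ≡ remQuot Q.size k
      split x e = ≡.trans (≡.sym (remQuot-combine (P.cell x) (Q.cell x))) (≡.cong (remQuot Q.size) e)

  integral-cong : ∀ {f g I J} → (∀ x → f x ≈ g x) → I ≈ J → HasIntegral M f I → HasIntegral M g J
  integral-cong f≈g I≈J h ε ε>0 with h ε ε>0
  ... | P , c , close , near =
    P , c , (λ x → ≤-respˡ (∣∣-cong (+-congʳ (f≈g x))) (close x)) ,
    ≤-respˡ (∣∣-cong (+-congˡ (-‿cong I≈J))) near

  integral-const : HasTotalMass M 1# → ∀ a → HasIntegral M (λ _ → a) a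
  integral-const mass a ε ε>0 = P , (λ _ → a) ,
      (λ _ → ≤-respˡ (sym (trans (∣∣-cong (-‿inverseʳ a)) (∣∣-nonNeg ≤-refl))) (<⇒≤ ε>0)) ,
      ≤-respˡ (sym (trans (∣∣-cong sum≈0) (∣∣-nonNeg ≤-refl))) (<⇒≤ ε>0)
    where
    everything : U ≐ (λ (_ : Point) → Fin.zero {0} ≡ zero)
    everything = (λ _ → ≡.refl) , λ _ → _
    P : Partition
    P = record { size = 1 ; cell = λ _ → zero ; measurable = λ { zero → resp everything U-borel } }
    sum≈0 : ∫simple P (λ _ → a) - a ≈ 0#
    sum≈0 = x≈y⇒x-y≈0 (trans (+-identityʳ _) (trans (*-congˡ
      (trans (μ-cong ((λ _ → _) , λ _ → ≡.refl) (Partition.measurable P zero) U-borel) (mass U-borel))) (*-identityʳ a)))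

  integral-+ : ∀ {f g I J} → HasIntegral M f I → HasIntegral M g J →
               HasIntegral M (λ x → f x + g x) (I + J)
  integral-+ {f} {g} {I} {J} hf hg ε ε>0 with hf (½ * ε) (½-pos ε>0) | hg (½ * ε) (½-pos ε>0)
  ... | P , c , c-close , c-near | Q , d , d-close , d-near =
      N , (λ k → c (π₁ k) + d (π₂ k)) ,
      (λ x → ≤-trans (≤-reflexive (∣∣-cong (trans (+-congˡ (-‿cong (values x))) (regroup (f x) (g x) _ _))))
                     (add (c-close x) (d-close x))) ,
      ≤-trans (≤-reflexive (∣∣-cong (trans (+-congʳ sums) (regroup _ _ I J)))) (add c-near d-near)
    where
    module P = Partition P
    module Q = Partition Q
    N = P ⊓ₚ Q
    module N = Partition N
    π₁ : Fin N.size → Fin P.size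
    π₁ k = proj₁ (remQuot Q.size k)
    π₂ : Fin N.size → Fin Q.size
    π₂ k = proj₂ (remQuot {P.size} Q.size k)
    coarser₁ : ∀ x → P.cell x ≡ π₁ (N.cell x)
    coarser₁ x = ≡.cong proj₁ (≡.sym (remQuot-combine (P.cell x) (Q.cell x)))
    coarser₂ : ∀ x → Q.cell x ≡ π₂ (N.cell x)
    coarser₂ x = ≡.cong proj₂ (≡.sym (remQuot-combine (P.cell x) (Q.cell x)))
    values : ∀ x → c (π₁ (N.cell x)) + d (π₂ (N.cell x)) ≈ c (P.cell x) + d (Q.cell x)
    values x = reflexive (≡.sym (≡.cong₂ (λ i j → c i + d j) (coarser₁ x) (coarser₂ x)))
    regroup : ∀ a b c d → (a + b) - (c + d) ≈ (a - c) + (b - d)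
    regroup = solve 4 (λ a b c d → (a :+ b) :- (c :+ d) := (a :- c) :+ (b :- d)) refl
    sums : ∫simple N (λ k → c (π₁ k) + d (π₂ k)) ≈ ∫simple P c + ∫simple Q d
    sums = begin
      ∫simple N (λ k → c (π₁ k) + d (π₂ k))
        ≈⟨ R-sum.sum-cong-≋ (λ k → distribʳ (μ (N.measurable k)) (c (π₁ k)) (d (π₂ k))) ⟩
      ∑[ k < N.size ] (c (π₁ k) * μ (N.measurable k) + d (π₂ k) * μ (N.measurable k))
        ≈⟨ R-sum.∑-distrib-+ (λ k → c (π₁ k) * μ (N.measurable k)) (λ k → d (π₂ k) * μ (N.measurable k)) ⟩
      ∫simple N (c ∘ π₁) + ∫simple N (d ∘ π₂)
        ≈⟨ +-cong (∫simple-refine P N π₁ coarser₁ c) (∫simple-refine Q N π₂ coarser₂ d) ⟨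
      ∫simple P c + ∫simple Q d ∎
    add : ∀ {a b} → ∣ a ∣ ≤ ½ * ε → ∣ b ∣ ≤ ½ * ε → ∣ a + b ∣ ≤ ε
    add {a} {b} ha hb = ≤-trans (∣∣-+ a b) (≤-trans (+-mono-≤ ha hb) (≤-reflexive (double-half ε)))

  -- With `∣ a ∣ ≤ 1#` the same approximation serves for the same `ε`, without division by `a`. The
  -- factors needed are ½, -½ and -1.
  integral-scale : ∀ {f I a} → ∣ a ∣ ≤ 1# → HasIntegral M f I → HasIntegral M (λ x → a * f x) (a * I)
  integral-scale {f} {I} {a} ∣a∣≤1 h ε ε>0 with h ε ε>0
  ... | P , c , close , near =
      P , (λ k → a * c k) ,
      (λ x → ≤-trans (≤-reflexive (∣∣-cong (factor (f x) (c (Partition.cell P x))))) (shrink (close x))) ,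
      ≤-trans (≤-reflexive (∣∣-cong (trans (+-congʳ sums) (factor _ I)))) (shrink near)
    where
    open Partition P
    factor : ∀ x y → a * x - a * y ≈ a * (x - y)
    factor = solve 3 (λ a x y → a :* x :- a :* y := a :* (x :- y)) refl a
    shrink : ∀ {x} → ∣ x ∣ ≤ ε → ∣ a * x ∣ ≤ ε
    shrink {x} h = ≤-trans (∣∣-*-≤ x ∣a∣≤1) (≤-trans (≤-reflexive (*-identityˡ _)) h)
    sums : ∫simple P (λ k → a * c k) ≈ a * ∫simple P c
    sums = trans (R-sum.sum-cong-≋ (λ k → *-assoc a (c k) (μ (measurable k))))
                 (sym (R-sum.*-distribˡ-sum a (λ k → c k * μ (measurable k))))

  module _ (variation : FiniteVariation M) where

    -- A simple function within `δ` of 0 has integral at most `δ` times the total variation. This is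
    -- where finite variation makes integrals well defined.
    integral-zero : ∀ {I} → HasIntegral M (λ _ → 0#) I → I ≈ 0#
    integral-zero {I} h = ∣∣≤small⇒≈0 small
      where
      b = proj₁ variation
      -- The summand `1#` makes the bound invertible and absorbs the distance from the simple
      -- integral to `I`: `δ * ∣ b ∣ + δ` is `δ * b′`.
      b′ = ∣ b ∣ + 1#
      b′>0 : 0# < b′
      b′>0 = ≤-respʳ (+-comm _ _) (proj₁ pos) , λ e → proj₂ pos (trans e (+-comm _ _))
        where pos = +-pos 0<1 (0≤∣x∣ b)
      -- On an empty cell the coefficient is unconstrained, but the measure vanishes.
      bound : ∀ δ → 0# < δ → ∣ I ∣ ≤ δ * b′
      bound δ δ>0 with h δ δ>0
      ... | P , c , close , near = ≤-trans (≤-reflexive (∣∣-cong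
              (solve 2 (λ i s → i := s :+ :- (s :- i)) refl I (∫simple P c))))
            (≤-trans (∣∣-+ (∫simple P c) (- (∫simple P c - I)))
            (≤-trans (+-mono-≤ simple-small (≤-trans (∣∣-neg _) near))
            (≤-reflexive (solve 2 (λ d b → d :* b :+ d := d :* (b :+ :1)) refl δ ∣ b ∣))))
        where
        open Partition P
        term-small : ∀ k → ∣ c k * μ (measurable k) ∣ ≤ δ * ∣ μ (measurable k) ∣
        term-small k with lem {P = ∃ λ x → cell x ≡ k}
        ... | yes (x , ≡.refl) = ∣∣-*-≤ (μ (measurable (cell x)))
                (≤-trans (≤-reflexive (∣∣-cong (sym (+-identityˡ _))))
                (≤-trans (∣∣-neg′ x) (close x)))
          where
          ∣∣-neg′ : ∀ x → ∣ 0# + c (cell x) ∣ ≤ ∣ 0# - c (cell x) ∣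
          ∣∣-neg′ x = ≤-respˡ (∣∣-cong (solve 1 (λ c → :- (:0 :- c) := :0 :+ c) refl (c (cell x))))
                              (∣∣-neg (0# - c (cell x)))
        ... | no empty = ≤-trans (≤-reflexive (trans (∣∣-cong (trans (*-congˡ
                  (μ-∅ (measurable k) λ x e → empty (x , e))) (zeroʳ _))) (∣∣-nonNeg ≤-refl)))
                (*-nonNeg (<⇒≤ δ>0) (0≤∣x∣ _))
        simple-small : ∣ ∫simple P c ∣ ≤ δ * ∣ b ∣
        simple-small = ≤-trans (∣sum∣≤sum∣∣ (λ k → c k * μ (measurable k)))
          (≤-trans (sum-mono term-small)
          (≤-trans (≤-reflexive (sym (R-sum.*-distribˡ-sum δ (λ k → ∣ μ (measurable k) ∣))))
          (*-monoˡ-≤ (<⇒≤ δ>0) (≤-trans (proj₂ variation P) (x≤∣x∣ b)))))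
      small : ∀ ε → 0# < ε → ∣ I ∣ ≤ ε
      small ε ε>0 = ≤-trans (bound (ε * b′ ⁻¹) (*-pos ε>0 (⁻¹-pos b′>0)))
        (≤-reflexive (trans (*-assoc ε (b′ ⁻¹) b′) (trans
          (*-congˡ (trans (*-comm _ _) (*-inverseʳ (0<⇒≉0 b′>0)))) (*-identityʳ ε))))

    integral-unique : ∀ {f I J} → HasIntegral M f I → HasIntegral M f J → I ≈ J
    integral-unique {f} {I} {J} hI hJ = x-y≈0⇒x≈y (trans (+-congˡ (sym (-1*x J)))
      (integral-zero (integral-cong (λ x → trans (+-congˡ (-1*x (f x))) (-‿inverseʳ (f x))) refl
        (integral-+ hI (integral-scale ∣-1∣≤1 hJ)))))
      where
      -1*x : ∀ x → (- 1#) * x ≈ - x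
      -1*x = solve 1 (λ x → (:- :1) :* x := :- x) refl
      ∣-1∣≤1 : ∣ - 1# ∣ ≤ 1#
      ∣-1∣≤1 = ≤-trans (∣∣-neg 1#) (≤-reflexive (∣∣-nonNeg (<⇒≤ 0<1)))

-- Glued points, slopes, Green's identity and harmonic functions.

module Laplacian (lem : ∀ {ℓ} → ExcludedMiddle ℓ) (R : RealField) (Γ : MetrizedGraph R) where
  open RealField R hiding (zero)
  open OnGraph lem R Γ
  open OrderedField lem R
  open SetoidReasoning setoid hiding (start)

  ≈ₚ-refl : ∀ {x} → x ≈ₚ x
  ≈ₚ-refl = EqC.reflexive Glue

  ≈ₚ-sym : ∀ {x y} → x ≈ₚ y → y ≈ₚ x
  ≈ₚ-sym = EqC.symmetric Glue

  ≈ₚ-trans : ∀ {x y z} → x ≈ₚ y → y ≈ₚ z → x ≈ₚ z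
  ≈ₚ-trans = EqC.transitive Glue

  start-point end-point : ∀ e → Segment R (len e)
  start-point e = segment 0# ≤-refl (<⇒≤ (0<len e))
  end-point   e = segment (len e) (<⇒≤ (0<len e)) ≤-refl

  lift-cong : ∀ {f : Point → ℝ} → (∀ {x y} → Glue x y → f x ≈ f y) → ∀ {x y} → x ≈ₚ y → f x ≈ f y
  lift-cong {f} = gfold isEquivalence f

  lift-⇔ : ∀ {T : Pred Point 0ℓ} → (∀ {x y} → Glue x y → T x ⇔ T y) → ∀ {x y} → x ≈ₚ y → T x ⇔ T y
  lift-⇔ {T} = gfold ⇔-isEquivalence T

  Interior : ∀ e → Segment R (len e) → Set
  Interior e t = 0# < val t × val t < len e

  interior-or-end : ∀ e t → Interior e t ⊎ val t ≈ 0# ⊎ val t ≈ len e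
  interior-or-end e t with ≈-dec 0# (val t) | ≈-dec (val t) (len e)
  ... | yes a | _     = inj₂ (inj₁ (sym a))
  ... | no _  | yes b = inj₂ (inj₂ b)
  ... | no a  | no b  = inj₁ ((Segment.0≤val t , a) , (Segment.val≤L t , b))

  -- The class of `vertex v`, described explicitly. As `_≈ₚ_` is a generated equivalence, two points
  -- are proved distinct by a predicate that `Glue` preserves; `AtInterior` plays this part for an
  -- interior point.
  AtVertex : Fin #V → Pred Point 0ℓ
  AtVertex v (vertex u) = u ≡ v
  AtVertex v (on e t)   = (val t ≈ 0# × p e ≡ v) ⊎ (val t ≈ len e × q e ≡ v)

  atVertex-glue : ∀ v {x y} → Glue x y → AtVertex v x ⇔ AtVertex v y
  atVertex-glue v (same e {s} {t} s≈t) = mk⇔ (move {s} {t} (sym s≈t)) (move {t} {s} s≈t)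
    where
    move : ∀ {s t} → val t ≈ val s → AtVertex v (on e s) → AtVertex v (on e t)
    move t≈s (inj₁ (s≈0 , h)) = inj₁ (trans t≈s s≈0 , h)
    move t≈s (inj₂ (s≈l , h)) = inj₂ (trans t≈s s≈l , h)
  atVertex-glue v (start e t≈0) = mk⇔
    (λ { (inj₁ (_ , h)) → h ; (inj₂ (t≈l , _)) → contradiction (trans (sym t≈0) t≈l) (proj₂ (0<len e)) })
    (λ h → inj₁ (t≈0 , h))
  atVertex-glue v (end e t≈l) = mk⇔
    (λ { (inj₂ (_ , h)) → h ; (inj₁ (t≈0 , _)) → contradiction (trans (sym t≈0) t≈l) (proj₂ (0<len e)) })
    (λ h → inj₂ (t≈l , h))

  atVertex-resp : ∀ v {x y} → x ≈ₚ y → AtVertex v x → AtVertex v y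
  atVertex-resp v x≈y = Equivalence.to (lift-⇔ (atVertex-glue v) x≈y)

  vertex-injective : ∀ {u v} → vertex u ≈ₚ vertex v → u ≡ v
  vertex-injective {v = v} u≈v = atVertex-resp v (≈ₚ-sym u≈v) ≡.refl

  interior≉vertex : ∀ {e t v} → Interior e t → ¬ on e t ≈ₚ vertex v
  interior≉vertex {v = v} ((_ , 0≉t) , (_ , t≉l)) e≈v with atVertex-resp v (≈ₚ-sym e≈v) ≡.refl
  ... | inj₁ (t≈0 , _) = 0≉t (sym t≈0)
  ... | inj₂ (t≈l , _) = t≉l t≈l

  AtInterior : ∀ e → Segment R (len e) → Pred Point 0ℓ
  AtInterior e t (vertex _) = ⊥
  AtInterior e t (on e′ s)  = e ≡ e′ × val t ≈ val s

  interior-same : ∀ {e t e′ t′} → Interior e t → on e t ≈ₚ on e′ t′ → e ≡ e′ × val t ≈ val t′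
  interior-same {e} {t} ((_ , 0≉t) , (_ , t≉l)) eq = Equivalence.to (lift-⇔ glue eq) (≡.refl , refl)
    where
    glue : ∀ {x y} → Glue x y → AtInterior e t x ⇔ AtInterior e t y
    glue (same e s≈s′)  = mk⇔ (λ (h , k) → h , trans k s≈s′) (λ (h , k) → h , trans k (sym s≈s′))
    glue (start e s≈0)  = mk⇔ (λ (_ , k) → 0≉t (sym (trans k s≈0))) (λ ())
    glue (end e s≈l)    = mk⇔ (λ { (≡.refl , k) → t≉l (trans k s≈l) }) (λ ())

  below-both : ∀ {a b} → 0# < a → 0# < b → ∃ λ ε → 0# < ε × ε ≤ a × ε ≤ b
  below-both {a} {b} a>0 b>0 with total a b
  ... | inj₁ a≤b = a , a>0 , ≤-refl , a≤b
  ... | inj₂ b≤a = b , b>0 , b≤a , ≤-refl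

  Slope⁺-lin : ∀ {f g e t s s′} a b → Slope⁺ f e t s → Slope⁺ g e t s′ →
               Slope⁺ (λ x → a * f x + b * g x) e t (a * s + b * s′)
  Slope⁺-lin {t = t} a b (ε₁ , ε₁>0 , fit₁ , eq₁) (ε₂ , ε₂>0 , fit₂ , eq₂)
    with below-both ε₁>0 ε₂>0
  ... | ε , ε>0 , ε≤ε₁ , ε≤ε₂ =
    ε , ε>0 , ≤-trans (+-mono-≤ ≤-refl ε≤ε₁) fit₁ , λ u t≤u u≤ →
      lin₂ (eq₁ u t≤u (≤-trans u≤ (+-mono-≤ ≤-refl ε≤ε₁))) (eq₂ u t≤u (≤-trans u≤ (+-mono-≤ ≤-refl ε≤ε₂)))
        (solve 9 (λ a b fu gu ft gt s s′ d → (a :* fu :+ b :* gu) :- ((a :* ft :+ b :* gt) :+ (a :* s :+ b :* s′) :* d)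
                    := a :* (fu :- (ft :+ s :* d)) :+ b :* (gu :- (gt :+ s′ :* d)))
               refl a b _ _ _ _ _ _ (val u - val t))

  Slope⁻-lin : ∀ {f g e t s s′} a b → Slope⁻ f e t s → Slope⁻ g e t s′ →
               Slope⁻ (λ x → a * f x + b * g x) e t (a * s + b * s′)
  Slope⁻-lin {t = t} a b (ε₁ , ε₁>0 , fit₁ , eq₁) (ε₂ , ε₂>0 , fit₂ , eq₂)
    with below-both ε₁>0 ε₂>0
  ... | ε , ε>0 , ε≤ε₁ , ε≤ε₂ =
    ε , ε>0 , ≤-trans fit₁ (shrink ε≤ε₁) , λ u t≤u u≤ →
      lin₂ (eq₁ u (≤-trans (shrink ε≤ε₁) t≤u) u≤) (eq₂ u (≤-trans (shrink ε≤ε₂) t≤u) u≤)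
        (solve 9 (λ a b fu gu ft gt s s′ d → (a :* fu :+ b :* gu) :- ((a :* ft :+ b :* gt) :+ (a :* s :+ b :* s′) :* d)
                    := a :* (fu :- (ft :+ s :* d)) :+ b :* (gu :- (gt :+ s′ :* d)))
               refl a b _ _ _ _ _ _ (val t - val u))
    where
    shrink : ∀ {ε ε′} → ε ≤ ε′ → val t - ε′ ≤ val t - ε
    shrink h = +-mono-≤ ≤-refl (-‿anti-≤ h)

  module _ {f : Point → ℝ} (f-cong : ∀ {x y} → x ≈ₚ y → f x ≈ f y) where

    Slope⁺-resp : ∀ {e t t′ s} → val t ≈ val t′ → Slope⁺ f e t s → Slope⁺ f e t′ s
    Slope⁺-resp {e} {t} {t′} {s} t≈t′ (ε , ε>0 , fit , eq) =
      ε , ε>0 , ≤-respˡ (+-congʳ t≈t′) fit , λ u t′≤u u≤ →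
        trans (eq u (≤-respˡ (sym t≈t′) t′≤u) (≤-respʳ (+-congʳ (sym t≈t′)) u≤))
              (+-cong (f-cong (return (same e t≈t′))) (*-congˡ (+-congˡ (-‿cong t≈t′))))

    Slope⁻-resp : ∀ {e t t′ s} → val t ≈ val t′ → Slope⁻ f e t s → Slope⁻ f e t′ s
    Slope⁻-resp {e} {t} {t′} {s} t≈t′ (ε , ε>0 , fit , eq) =
      ε , ε>0 , ≤-respʳ (+-congʳ t≈t′) fit , λ u ≤u u≤t′ →
        trans (eq u (≤-respˡ (+-congʳ (sym t≈t′)) ≤u) (≤-respʳ (sym t≈t′) u≤t′))
              (+-cong (f-cong (return (same e t≈t′))) (*-congˡ (+-congʳ t≈t′)))

  AffineOn : (Point → ℝ) → Fin #E → ℝ → Set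
  AffineOn f e m = ∀ u → f (on e u) ≈ f (vertex (p e)) + m * val u

  Slope⁺-affine : ∀ {f e m} → AffineOn f e m → ∀ t {s} → Slope⁺ f e t s → s ≈ m
  Slope⁺-affine {f} {e} {m} aff t {s} (ε , ε>0 , fit , eq) = *-cancelˡ (0<⇒≉0 ε>0)
    (lin₃ (eq u t≤u ≤-refl) (aff u) (aff t)
      (solve 7 (λ ε s m fu ft c t → ε :* s :- ε :* m :=
         (:- :1) :* (fu :- (ft :+ s :* ((t :+ ε) :- t))) :+ :1 :* (fu :- (c :+ m :* (t :+ ε)))
           :+ (:- :1) :* (ft :- (c :+ m :* t))) refl ε s m (f (on e u)) (f (on e t)) (f (vertex (p e))) (val t)))
    where
    t≤u : val t ≤ val t + ε
    t≤u = ≤-by (<⇒≤ ε>0) refl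
    u : Segment R (len e)
    u = segment (val t + ε) (≤-trans (Segment.0≤val t) t≤u) fit

  Slope⁻-affine : ∀ {f e m} → AffineOn f e m → ∀ t {s} → Slope⁻ f e t s → s ≈ - m
  Slope⁻-affine {f} {e} {m} aff t {s} (ε , ε>0 , fit , eq) = *-cancelˡ (0<⇒≉0 ε>0)
    (lin₃ (eq u ≤-refl u≤t) (aff u) (aff t)
      (solve 7 (λ ε s m fu ft c t → ε :* s :- ε :* (:- m) :=
         (:- :1) :* (fu :- (ft :+ s :* (t :- (t :- ε)))) :+ :1 :* (fu :- (c :+ m :* (t :- ε)))
           :+ (:- :1) :* (ft :- (c :+ m :* t))) refl ε s m (f (on e u)) (f (on e t)) (f (vertex (p e))) (val t)))
    where
    u≤t : val t - ε ≤ val t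
    u≤t = ≤-by (<⇒≤ ε>0) (solve 2 (λ t ε → t := (t :- ε) :+ ε) refl (val t) ε)
    u : Segment R (len e)
    u = segment (val t - ε) fit (≤-trans u≤t (Segment.val≤L t))

  -- The slope sum of `at-vertex` as a function of the outgoing slopes at the starts and the ends of
  -- all edges, so that its linearity can be stated.
  ∂ : (s⁺ s⁻ : Fin #E → ℝ) → Fin #V → ℝ
  ∂ s⁺ s⁻ v = ∑[ e < #E ] ((if does (p e ≟ v) then s⁺ e else 0#) + (if does (q e ≟ v) then s⁻ e else 0#))

  ∂-cong : ∀ {s⁺ s⁻ r⁺ r⁻} → (∀ e → s⁺ e ≈ r⁺ e) → (∀ e → s⁻ e ≈ r⁻ e) → ∀ v → ∂ s⁺ s⁻ v ≈ ∂ r⁺ r⁻ v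
  ∂-cong {s⁺} {s⁻} {r⁺} {r⁻} h⁺ h⁻ v = R-sum.sum-cong-≋ term
    where
    term : ∀ e →
      (if does (p e ≟ v) then s⁺ e else 0#) + (if does (q e ≟ v) then s⁻ e else 0#) ≈
      (if does (p e ≟ v) then r⁺ e else 0#) + (if does (q e ≟ v) then r⁻ e else 0#)
    term e with p e ≟ v | q e ≟ v
    ... | yes _ | yes _ = +-cong (h⁺ e) (h⁻ e)
    ... | yes _ | no _  = +-congʳ (h⁺ e)
    ... | no _  | yes _ = +-congˡ (h⁻ e)
    ... | no _  | no _  = refl

  ∂-lin : ∀ a b s⁺ s⁻ r⁺ r⁻ v →
    ∂ (λ e → a * s⁺ e + b * r⁺ e) (λ e → a * s⁻ e + b * r⁻ e) v ≈ a * ∂ s⁺ s⁻ v + b * ∂ r⁺ r⁻ v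
  ∂-lin a b s⁺ s⁻ r⁺ r⁻ v = begin
    _ ≈⟨ R-sum.sum-cong-≋ term ⟩
    ∑[ e < #E ] (a * S e + b * T e)
      ≈⟨ R-sum.∑-distrib-+ (λ e → a * S e) (λ e → b * T e) ⟩
    ∑[ e < #E ] (a * S e) + ∑[ e < #E ] (b * T e)
      ≈⟨ +-cong (R-sum.*-distribˡ-sum a S) (R-sum.*-distribˡ-sum b T) ⟨
    a * ∂ s⁺ s⁻ v + b * ∂ r⁺ r⁻ v ∎
    where
    S T : Fin #E → ℝ
    S e = (if does (p e ≟ v) then s⁺ e else 0#) + (if does (q e ≟ v) then s⁻ e else 0#)
    T e = (if does (p e ≟ v) then r⁺ e else 0#) + (if does (q e ≟ v) then r⁻ e else 0#)
    term : ∀ e → (if does (p e ≟ v) then a * s⁺ e + b * r⁺ e else 0#)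
               + (if does (q e ≟ v) then a * s⁻ e + b * r⁻ e else 0#) ≈ a * S e + b * T e
    term e with p e ≟ v | q e ≟ v
    ... | yes _ | yes _ =
      solve 6 (λ a b x x′ y y′ → (a :* x :+ b :* y) :+ (a :* x′ :+ b :* y′) :=
                                 a :* (x :+ x′) :+ b :* (y :+ y′)) refl a b _ _ _ _
    ... | yes _ | no _  = solve 4 (λ a b x y → (a :* x :+ b :* y) :+ :0 := a :* (x :+ :0) :+ b :* (y :+ :0)) refl a b _ _
    ... | no _  | yes _ = solve 4 (λ a b x y → :0 :+ (a :* x :+ b :* y) := a :* (:0 :+ x) :+ b :* (:0 :+ y)) refl a b _ _
    ... | no _  | no _  = solve 2 (λ a b → :0 :+ :0 := a :* (:0 :+ :0) :+ b :* (:0 :+ :0)) refl a b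

  -- Δ f = h, with the case distinction of SlopeSum resolved for each kind of point.
  record Lap (f h : Point → ℝ) : Set where
    field
      f-cong   : ∀ {x y} → x ≈ₚ y → f x ≈ f y
      interior : ∀ e t → Interior e t →
        ∃₂ λ s⁺ s⁻ → Slope⁺ f e t s⁺ × Slope⁻ f e t s⁻ × - (s⁺ + s⁻) ≈ h (on e t)
      atVertex : ∀ v → ∃₂ λ s⁺ s⁻ →
        (∀ e t → val t ≈ 0# → Slope⁺ f e t (s⁺ e)) ×
        (∀ e t → val t ≈ len e → Slope⁻ f e t (s⁻ e)) × - ∂ s⁺ s⁻ v ≈ h (vertex v)

  open Lap

  -- An interior point is not a vertex, so only one constructor of `SlopeSum` can occur at each
  -- point. Its witness is merely glued to the given point, whence the transport of the slopes.
  fromHasLaplacian : ∀ {f h} → (∀ {x y} → x ≈ₚ y → f x ≈ f y) → HasLaplacian f h → Lap f h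
  fromHasLaplacian {f} {h} f-cong has = record { f-cong = f-cong ; interior = inner ; atVertex = atV }
    where
    inner : ∀ e t → Interior e t →
      ∃₂ λ s⁺ s⁻ → Slope⁺ f e t s⁺ × Slope⁻ f e t s⁻ × - (s⁺ + s⁻) ≈ h (on e t)
    inner e t t-int with has (on e t)
    ... | _ , at-vertex v eq _ _ _ _ , _ = contradiction eq (interior≉vertex t-int)
    ... | _ , at-interior e′ t′ eq _ _ S⁺ S⁻ , σ with interior-same t-int eq
    ... | ≡.refl , t≈t′ = _ , _ , Slope⁺-resp f-cong (sym t≈t′) S⁺ , Slope⁻-resp f-cong (sym t≈t′) S⁻ , σ
    atV : ∀ v → ∃₂ λ s⁺ s⁻ →
      (∀ e t → val t ≈ 0# → Slope⁺ f e t (s⁺ e)) ×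
      (∀ e t → val t ≈ len e → Slope⁻ f e t (s⁻ e)) × - ∂ s⁺ s⁻ v ≈ h (vertex v)
    atV v with has (vertex v)
    ... | _ , at-interior e t eq 0<t t<l _ _ , _ = contradiction (≈ₚ-sym eq) (interior≉vertex (0<t , t<l))
    ... | _ , at-vertex v′ eq s⁺ s⁻ S⁺ S⁻ , σ with vertex-injective eq
    ... | ≡.refl = s⁺ , s⁻ , S⁺ , S⁻ , σ

  lap-lin : ∀ {f g h k} a b → Lap f h → Lap g k → Lap (λ x → a * f x + b * g x) (λ x → a * h x + b * k x)
  lap-lin {f} {g} {h} {k} a b F G = record
    { f-cong = λ e → +-cong (*-congˡ (f-cong F e)) (*-congˡ (f-cong G e))
    ; interior = λ e t t-int →
        let (s⁺ , s⁻ , S⁺ , S⁻ , σ) = interior F e t t-int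
            (r⁺ , r⁻ , R⁺ , R⁻ , ρ) = interior G e t t-int
        in _ , _ , Slope⁺-lin {f} {g} a b S⁺ R⁺ , Slope⁻-lin {f} {g} a b S⁻ R⁻ ,
           lin₂ σ ρ (solve 8 (λ a b s s′ r r′ h k → :- ((a :* s :+ b :* r) :+ (a :* s′ :+ b :* r′)) :- (a :* h :+ b :* k)
              := a :* (:- (s :+ s′) :- h) :+ b :* (:- (r :+ r′) :- k)) refl a b s⁺ s⁻ r⁺ r⁻ _ _)
    ; atVertex = λ v →
        let (s⁺ , s⁻ , S⁺ , S⁻ , σ) = atVertex F v
            (r⁺ , r⁻ , R⁺ , R⁻ , ρ) = atVertex G v
        in _ , _ , (λ e t t≈0 → Slope⁺-lin {f} {g} a b (S⁺ e t t≈0) (R⁺ e t t≈0)) ,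
           (λ e t t≈l → Slope⁻-lin {f} {g} a b (S⁻ e t t≈l) (R⁻ e t t≈l)) ,
           trans (-‿cong (∂-lin a b s⁺ s⁻ r⁺ r⁻ v))
             (lin₂ σ ρ (solve 6 (λ a b s r h k → :- (a :* s :+ b :* r) :- (a :* h :+ b :* k)
              := a :* (:- s :- h) :+ b :* (:- r :- k)) refl a b (∂ s⁺ s⁻ v) (∂ r⁺ r⁻ v) _ _))
    }

  lap-resp : ∀ {f h k} → (∀ x → h x ≈ k x) → Lap f h → Lap f k
  lap-resp h≈k F = record
    { f-cong = f-cong F
    ; interior = λ e t t-int → let (s⁺ , s⁻ , S⁺ , S⁻ , σ) = interior F e t t-int
                               in s⁺ , s⁻ , S⁺ , S⁻ , trans σ (h≈k _)
    ; atVertex = λ v → let (s⁺ , s⁻ , S⁺ , S⁻ , σ) = atVertex F v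
                       in s⁺ , s⁻ , S⁺ , S⁻ , trans σ (h≈k _)
    }

  -- A condition on `T` whose supremum is to be taken: the bounds on `T` belong to it so that the
  -- set is bounded and each member is a parameter of the edge.
  AffineUpTo : (Point → ℝ) → Fin #E → (c m T : ℝ) → Set
  AffineUpTo f e c m T = 0# ≤ T × T ≤ len e × (∀ u → val u ≤ T → f (on e u) ≈ c + m * val u)

  -- Two distinct points common to the two affine pieces determine both slopes.
  affine-glue : ∀ {f e c m T s⁻} (σ : Segment R (len e)) (S⁻ : Slope⁻ f e σ s⁻) →
    AffineUpTo f e c m T → val σ - proj₁ S⁻ < T → T ≤ val σ →
    s⁻ ≈ - m × AffineUpTo f e c m (val σ)
  affine-glue {f} {e} {c} {m} {T} {s⁻} σ (ε , ε>0 , fit , eq) (0≤T , T≤len , T-aff) a<T T≤σ =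
      s⁻≈ , Segment.0≤val σ , Segment.val≤L σ , aff
    where
    a  = val σ - ε
    fσ = f (on e σ)
    T-point a-point : Segment R (len e)
    T-point = segment T 0≤T T≤len
    a-point = segment a fit (≤-trans (<⇒≤ a<T) T≤len)
    T-eq : c + m * T ≈ fσ + s⁻ * (val σ - T)
    T-eq = trans (sym (T-aff T-point ≤-refl)) (eq T-point (<⇒≤ a<T) T≤σ)
    a-eq : c + m * a ≈ fσ + s⁻ * (val σ - a)
    a-eq = trans (sym (T-aff a-point (<⇒≤ a<T))) (eq a-point ≤-refl (≤-trans (<⇒≤ a<T) T≤σ))
    s⁻≈ : s⁻ ≈ - m
    s⁻≈ = *-cancelˡ (0<⇒≉0 (0<y-x a<T)) (lin₂ T-eq a-eq
      (solve 7 (λ T σ a s m c fσ → (T :- a) :* s :- (T :- a) :* (:- m) :=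
          :1 :* ((c :+ m :* T) :- (fσ :+ s :* (σ :- T)))
          :+ (:- :1) :* ((c :+ m :* a) :- (fσ :+ s :* (σ :- a))))
        refl T (val σ) a s⁻ m c fσ))
    fσ≈ : fσ ≈ c + m * val σ
    fσ≈ = lin₂ T-eq s⁻≈ (solve 6 (λ T σ s m c fσ → fσ :- (c :+ m :* σ) :=
          (:- :1) :* ((c :+ m :* T) :- (fσ :+ s :* (σ :- T)))
          :+ (T :- σ) :* (s :- (:- m))) refl T (val σ) s⁻ m c fσ)
    aff : ∀ u → val u ≤ val σ → f (on e u) ≈ c + m * val u
    aff u u≤σ with total (val u) a
    ... | inj₁ u≤a = T-aff u (≤-trans u≤a (<⇒≤ a<T))
    ... | inj₂ a≤u = lin₃ (eq u a≤u u≤σ) fσ≈ s⁻≈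
            (solve 7 (λ fu fσ s σ u c m → fu :- (c :+ m :* u) :=
               :1 :* (fu :- (fσ :+ s :* (σ :- u))) :+ :1 :* (fσ :- (c :+ m :* σ))
               :+ (σ :- u) :* (s :- (:- m))) refl (f (on e u)) fσ s⁻ (val σ) (val u) c m)

  affine-continue : ∀ {f e c m s⁺} (σ : Segment R (len e)) (S⁺ : Slope⁺ f e σ s⁺) → s⁺ ≈ m →
    AffineUpTo f e c m (val σ) → AffineUpTo f e c m (val σ + proj₁ S⁺)
  affine-continue {f} {e} {c} {m} {s⁺} σ (ε , ε>0 , fit , eq) s⁺≈m (0≤σ , _ , aff) =
      ≤-trans 0≤σ (≤-by (<⇒≤ ε>0) refl) , fit , aff′
    where
    aff′ : ∀ u → val u ≤ val σ + ε → f (on e u) ≈ c + m * val u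
    aff′ u u≤ with total (val u) (val σ)
    ... | inj₁ u≤σ = aff u u≤σ
    ... | inj₂ σ≤u = lin₃ (eq u σ≤u u≤) (aff σ ≤-refl) s⁺≈m
            (solve 7 (λ fu fσ s σ u c m → fu :- (c :+ m :* u) :=
               :1 :* (fu :- (fσ :+ s :* (u :- σ))) :+ :1 :* (fσ :- (c :+ m :* σ))
               :+ (u :- σ) :* (s :- m)) refl (f (on e u)) (f (on e σ)) s⁺ (val σ) (val u) c m)

  affine-start : ∀ {f e s} (S⁺ : Slope⁺ f e (start-point e) s) →
    AffineUpTo f e (f (on e (start-point e))) s (proj₁ S⁺)
  affine-start (ε , ε>0 , fit , eq) = <⇒≤ ε>0 , ≤-respˡ (+-identityˡ ε) fit , λ u u≤ →
    trans (eq u (Segment.0≤val u) (≤-respʳ (sym (+-identityˡ ε)) u≤))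
          (+-congˡ (*-congˡ (solve 1 (λ u → u :- :0 := u) refl (val u))))

  -- The affine behaviour next to the start of the edge persists up to the supremum σ of the
  -- parameters it reaches, and beyond σ unless σ is the end, as the slopes at σ match.
  affine-throughout : ∀ {f e c m T₀} → 0# < T₀ → AffineUpTo f e c m T₀ →
    (∀ σ → Interior e σ → ∃₂ λ s⁺ s⁻ → Slope⁺ f e σ s⁺ × Slope⁻ f e σ s⁻ × - (s⁺ + s⁻) ≈ 0#) →
    (∀ σ → val σ ≈ len e → ∃ (Slope⁻ f e σ)) →
    ∀ u → f (on e u) ≈ c + m * val u
  affine-throughout {f} {e} {c} {m} {T₀} 0<T₀ S-T₀ balanced at-end
    with supremum (AffineUpTo f e c m) (T₀ , S-T₀) (len e , λ x s → proj₁ (proj₂ s))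
  ... | s , bound , least = conclude (≈-dec s (len e))
    where
    0<s : 0# < s
    0<s = <-≤-trans 0<T₀ (bound T₀ S-T₀)
    s≤len : s ≤ len e
    s≤len = least (len e) (λ x S-x → proj₁ (proj₂ S-x))
    σ : Segment R (len e)
    σ = segment s (<⇒≤ 0<s) s≤len

    reach : ∀ {s⁻} → Slope⁻ f e σ s⁻ → s⁻ ≈ - m × AffineUpTo f e c m s
    reach S⁻@(ε , ε>0 , _) with lem {P = ∃ λ T → AffineUpTo f e c m T × s - ε < T}
    ... | yes (T , S-T , a<T) = affine-glue {f} σ S⁻ S-T a<T (bound T S-T)
    -- Otherwise `s - ε` would bound the set, against the minimality of `s`.
    ... | no none = contradiction (least (s - ε) below) (<⇒≱ (0<y-x⁻¹ (<-≤-trans ε>0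
            (≤-reflexive (solve 2 (λ s ε → ε := s :- (s :- ε)) refl s ε)))))
      where
      below : ∀ T → AffineUpTo f e c m T → T ≤ s - ε
      below T S-T with ≤-dec T (s - ε)
      ... | yes T≤ = T≤
      ... | no  T≰ = contradiction (T , S-T , ≰⇒> T≰) none

    conclude : Dec (s ≈ len e) → ∀ u → f (on e u) ≈ c + m * val u
    conclude (yes s≈len) u =
      proj₂ (proj₂ (proj₂ (reach (proj₂ (at-end σ s≈len))))) u (≤-respʳ (sym s≈len) (Segment.val≤L u))
    conclude (no s≉len) u with balanced σ (0<s , s≤len , s≉len)
    ... | s⁺ , s⁻ , S⁺@(ε , ε>0 , _) , S⁻ , balance with reach S⁻
    -- The slopes at an interior `σ` cancel, so the affine range would reach `s + ε`, beyond its
    -- supremum.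
    ... | s⁻≈ , S-s = contradiction (bound (s + ε) (affine-continue {f} σ S⁺ s⁺≈m S-s))
            (<⇒≱ (0<y-x⁻¹ (<-≤-trans ε>0 (≤-reflexive (solve 2 (λ s ε → ε := (s :+ ε) :- s) refl s ε)))))
      where
      s⁺≈m : s⁺ ≈ m
      s⁺≈m = lin₂ balance s⁻≈
        (solve 3 (λ s⁺ s⁻ m → s⁺ :- m := (:- :1) :* (:- (s⁺ :+ s⁻) :- :0)
                    :+ (:- :1) :* (s⁻ :- (:- m))) refl s⁺ s⁻ m)

  edge-affine : ∀ {f h} → Lap f h → ∀ e → (∀ t → Interior e t → h (on e t) ≈ 0#) → ∃ (AffineOn f e)
  edge-affine {f} F e harmonic with atVertex F (p e)
  ... | s⁺ , _ , S⁺ , _ = s⁺ e , λ u → trans (aff u) (+-congʳ (f-cong F (return (start e refl))))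
    where
    aff : ∀ u → f (on e u) ≈ f (on e (start-point e)) + s⁺ e * val u
    aff = affine-throughout {f} (proj₁ (proj₂ (S⁺ e (start-point e) refl))) (affine-start {f} (S⁺ e (start-point e) refl))
      (λ σ σ-int → let (r⁺ , r⁻ , R⁺ , R⁻ , balance) = interior F e σ σ-int
                   in r⁺ , r⁻ , R⁺ , R⁻ , trans balance (harmonic σ σ-int))
      (λ σ σ≈len → let (_ , r⁻ , _ , R⁻ , _) = atVertex F (q e) in r⁻ e , R⁻ e σ σ≈len)

  -- Summation by parts: after exchanging the sums, an edge sees `φ` only at its two end points.
  ∂-pairing : ∀ (φ : Fin #V → ℝ) s⁺ s⁻ →
    ∑[ v < #V ] (φ v * ∂ s⁺ s⁻ v) ≈ ∑[ e < #E ] (φ (p e) * s⁺ e + φ (q e) * s⁻ e)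
  ∂-pairing φ s⁺ s⁻ = begin
    ∑[ v < #V ] (φ v * ∂ s⁺ s⁻ v)
      ≈⟨ R-sum.sum-cong-≋ (λ v → R-sum.*-distribˡ-sum (φ v) (λ e → A e v + B e v)) ⟩
    ∑[ v < #V ] ∑[ e < #E ] (φ v * (A e v + B e v))
      ≈⟨ R-sum.∑-comm (λ v e → φ v * (A e v + B e v)) ⟩
    ∑[ e < #E ] ∑[ v < #V ] (φ v * (A e v + B e v))
      ≈⟨ R-sum.sum-cong-≋ term ⟩
    ∑[ e < #E ] (φ (p e) * s⁺ e + φ (q e) * s⁻ e) ∎
    where
    A B : Fin #E → Fin #V → ℝ
    A e v = if does (p e ≟ v) then s⁺ e else 0#
    B e v = if does (q e ≟ v) then s⁻ e else 0#
    push : ∀ (a v : Fin #V) s → φ v * (if does (a ≟ v) then s else 0#) ≈ (if does (a ≟ v) then φ v * s else 0#)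
    push a v s with a ≟ v
    ... | yes _ = refl
    ... | no  _ = zeroʳ (φ v)
    term : ∀ e → ∑[ v < #V ] (φ v * (A e v + B e v)) ≈ φ (p e) * s⁺ e + φ (q e) * s⁻ e
    term e = trans (R-sum.sum-cong-≋ (λ v → trans (distribˡ (φ v) (A e v) (B e v))
                      (+-cong (push (p e) v (s⁺ e)) (push (q e) v (s⁻ e)))))
      (trans (R-sum.∑-distrib-+ (λ v → if does (p e ≟ v) then φ v * s⁺ e else 0#)
                                (λ v → if does (q e ≟ v) then φ v * s⁻ e else 0#))
        (+-cong (sum-single (p e) (λ v → φ v * s⁺ e)) (sum-single (q e) (λ v → φ v * s⁻ e))))

  ends-affine : ∀ {f h} → Lap f h → ∀ {e m} → AffineOn f e m → f (vertex (q e)) ≈ f (vertex (p e)) + m * len e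
  ends-affine F {e} aff = trans (sym (f-cong F (return (end e refl)))) (aff (end-point e))

  -- Green's identity, with the Dirichlet pairing of the slopes on the right. For equal functions it
  -- is the energy, and its symmetry in `f` and `g` later yields that of the voltage kernel.
  green-pairing : ∀ {f g h k} (F : Lap f h) (G : Lap g k) {m n : Fin #E → ℝ} →
    (∀ e → AffineOn f e (m e)) → (∀ e → AffineOn g e (n e)) →
    ∑[ v < #V ] (f (vertex v) * k (vertex v)) ≈ ∑[ e < #E ] (m e * n e * len e)
  green-pairing {f} {g} {h} {k} F G {m} {n} f-aff g-aff = begin
    ∑[ v < #V ] (f (vertex v) * k (vertex v))     ≈⟨ R-sum.sum-cong-≋ (λ v → *-congˡ (k≈ v)) ⟩
    ∑[ v < #V ] (f (vertex v) * ∂ (λ e → - n e) n v)   ≈⟨ ∂-pairing (λ v → f (vertex v)) (λ e → - n e) n ⟩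
    ∑[ e < #E ] (f (vertex (p e)) * - n e + f (vertex (q e)) * n e)
      ≈⟨ R-sum.sum-cong-≋ (λ e → lin₁ (ends-affine F (f-aff e))
        (solve 5 (λ n a b m l → (a :* (:- n) :+ b :* n) :- m :* n :* l := n :* (b :- (a :+ m :* l)))
          refl (n e) (f (vertex (p e))) (f (vertex (q e))) (m e) (len e))) ⟩
    ∑[ e < #E ] (m e * n e * len e) ∎
    where
    -- Affinity forces the outgoing slopes of `g`: `n e` at the start of `e` and `- n e` at its end.
    -- The sign in the Laplacian reverses both.
    k≈ : ∀ v → k (vertex v) ≈ ∂ (λ e → - n e) n v
    k≈ v with atVertex G v
    ... | s⁺ , s⁻ , S⁺ , S⁻ , σ = begin
      k (vertex v)     ≈⟨ σ ⟨
      - ∂ s⁺ s⁻ v      ≈⟨ -‿cong (∂-cong (λ e → Slope⁺-affine {g} (g-aff e) (start-point e) (S⁺ e _ refl))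
                                         (λ e → Slope⁻-affine {g} (g-aff e) (end-point e) (S⁻ e _ refl)) v) ⟩
      -- A vanishing second summand brings the negation into the shape of `∂-lin`.
      - ∂ n (λ e → - n e) v  ≈⟨ solve 1 (λ x → :- x := :- :1 :* x :+ :0 :* x) refl _ ⟩
      - 1# * ∂ n (λ e → - n e) v + 0# * ∂ n (λ e → - n e) v
        ≈⟨ ∂-lin (- 1#) 0# n (λ e → - n e) n (λ e → - n e) v ⟨
      _ ≈⟨ ∂-cong (λ e → solve 1 (λ n → :- :1 :* n :+ :0 :* n := :- n) refl (n e))
                  (λ e → solve 1 (λ n → :- :1 :* (:- n) :+ :0 :* (:- n) := n) refl (n e)) v ⟩
      ∂ (λ e → - n e) n v ∎

  harmonic-constant : ∀ {f} → Lap f (λ _ → 0#) → ∀ x y → f x ≈ f y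
  harmonic-constant {f} F x y = trans (proj₂ (to-vertex x)) (trans
      (gfold isEquivalence (λ v → f (vertex v)) along (connected (proj₁ (to-vertex x)) (proj₁ (to-vertex y))))
      (sym (proj₂ (to-vertex y))))
    where
    affine : ∀ e → ∃ (AffineOn f e)
    affine e = edge-affine F e (λ _ _ → refl)
    m : Fin #E → ℝ
    m e = proj₁ (affine e)
    energy≈0 : ∑[ e < #E ] (m e * m e * len e) ≈ 0#
    energy≈0 = trans (sym (green-pairing F F (proj₂ ∘ affine) (proj₂ ∘ affine))) (sum-zero {#V} (λ v → zeroʳ _))
    square≈0 : ∀ {a} → a * a ≈ 0# → a ≈ 0#
    square≈0 {a} e with ≈-dec a 0#
    ... | yes a≈0 = a≈0
    ... | no  a≉0 = *-zeroˡ-cancel a≉0 e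
    m≈0 : ∀ e → m e ≈ 0#
    m≈0 e = square≈0 (*-zeroˡ-cancel (0<⇒≉0 (0<len e)) (trans (*-comm _ _)
      (sum-nonNeg-zero {#E} (λ e → *-nonNeg (square-nonNeg (m e)) (<⇒≤ (0<len e))) energy≈0 e)))
    flat : ∀ e u → f (on e u) ≈ f (vertex (p e))
    flat e u = trans (proj₂ (affine e) u) (trans (+-congˡ (trans (*-congʳ (m≈0 e)) (zeroˡ _))) (+-identityʳ _))
    along : ∀ {u v} → Link p q U u v → f (vertex u) ≈ f (vertex v)
    along (link e _) = trans (sym (flat e (end-point e))) (f-cong F (return (end e refl)))
    to-vertex : ∀ x → ∃ λ v → f x ≈ f (vertex v)
    to-vertex (vertex v) = v , refl
    to-vertex (on e t)   = p e , flat e t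

-- Uniqueness of potentials and the tent functions.

module Potential (lem : ∀ {ℓ} → ExcludedMiddle ℓ) (R : RealField) (Γ : MetrizedGraph R) where
  open RealField R hiding (zero)
  open OnGraph lem R Γ
  open OrderedField lem R
  open Laplacian lem R Γ
  open Lap
  open SetoidReasoning setoid hiding (start)
  open Min totalOrder using (_⊓_; ⊓-cong; ⊓-comm; x≤y⇒x⊓y≈x; x≤y⇒y⊓x≈x)

  δ-at : ∀ {x y} → x ≈ₚ y → δ y x ≈ 1#
  δ-at {x} {y} x≈y with lem {P = x ≈ₚ y}
  ... | yes _  = refl
  ... | no x≉y = contradiction x≈y x≉y

  δ-off : ∀ {x y} → ¬ x ≈ₚ y → δ y x ≈ 0#
  δ-off {x} {y} x≉y with lem {P = x ≈ₚ y}
  ... | yes x≈y = contradiction x≈y x≉y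
  ... | no _    = refl

  δ-cong : ∀ {y y′} → y ≈ₚ y′ → ∀ x → δ y x ≈ δ y′ x
  δ-cong {y} {y′} y≈y′ x with lem {P = x ≈ₚ y}
  ... | yes x≈y = sym (δ-at (≈ₚ-trans x≈y y≈y′))
  ... | no  x≉y = sym (δ-off (λ x≈y′ → x≉y (≈ₚ-trans x≈y′ (≈ₚ-sym y≈y′))))

  δ-vertex : ∀ u v → δ (vertex u) (vertex v) ≈ (if does (u ≟ v) then 1# else 0#)
  δ-vertex u v with u ≟ v
  ... | yes ≡.refl = δ-at {vertex u} ≈ₚ-refl
  ... | no  u≢v    = δ-off (λ eq → u≢v (≡.sym (vertex-injective eq)))

  -- The difference is harmonic, hence constant. The constant stays open as the difference at `w`,
  -- to be evaluated later where both functions are known.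
  lap-unique : ∀ {f g h} → Lap f h → Lap g h → ∀ x w → f x - g x ≈ f w - g w
  lap-unique {f} {g} {h} F G x w = begin
    f x - g x               ≈⟨ difference (f x) (g x) ⟨
    1# * f x + - 1# * g x   ≈⟨ harmonic-constant (lap-resp zero-laplacian (lap-lin 1# (- 1#) F G)) x w ⟩
    1# * f w + - 1# * g w   ≈⟨ difference (f w) (g w) ⟩
    f w - g w               ∎
    where
    difference : ∀ a b → 1# * a + - 1# * b ≈ a - b
    difference = solve 2 (λ a b → :1 :* a :+ :- :1 :* b := a :- b) refl
    zero-laplacian : ∀ x → 1# * h x + - 1# * h x ≈ 0#
    zero-laplacian x = trans (difference (h x) (h x)) (-‿inverseʳ (h x))

  Slope⁺-cong : ∀ {f e t s s′} → s ≈ s′ → Slope⁺ f e t s → Slope⁺ f e t s′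
  Slope⁺-cong s≈ (ε , ε>0 , fit , eq) = ε , ε>0 , fit , λ u a b → trans (eq u a b) (+-congˡ (*-congʳ s≈))

  Slope⁻-cong : ∀ {f e t s s′} → s ≈ s′ → Slope⁻ f e t s → Slope⁻ f e t s′
  Slope⁻-cong s≈ (ε , ε>0 , fit , eq) = ε , ε>0 , fit , λ u a b → trans (eq u a b) (+-congˡ (*-congʳ s≈))

  if-same : ∀ {n} (i : Fin n) {a b : ℝ} → (if does (i ≟ i) then a else b) ≡ a
  if-same i with i ≟ i
  ... | yes _  = ≡.refl
  ... | no i≢i = contradiction ≡.refl i≢i

  if-differ : ∀ {n} {i j : Fin n} → i ≢ j → {a b : ℝ} → (if does (i ≟ j) then a else b) ≡ b
  if-differ {i = i} {j} i≢j with i ≟ j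
  ... | yes i≡j = contradiction i≡j i≢j
  ... | no _    = ≡.refl

  -- For functions that vary along one edge only: the tents, with outgoing slopes 1 - l and l, and
  -- the ramp of a bridge, with 1 and -1.
  ∂-single : ∀ e a b v →
    ∂ (λ e′ → if does (e ≟ e′) then a else 0#) (λ e′ → if does (e ≟ e′) then b else 0#) v ≈
    a * δ (vertex (p e)) (vertex v) + b * δ (vertex (q e)) (vertex v)
  ∂-single e a b v = trans (R-sum.sum-cong-≋ term) (trans
      (sum-single e (λ e′ → (if does (p e′ ≟ v) then a else 0#) + (if does (q e′ ≟ v) then b else 0#)))
      (+-cong (gate (p e) a) (gate (q e) b)))
    where
    term : ∀ e′ →
      (if does (p e′ ≟ v) then (if does (e ≟ e′) then a else 0#) else 0#) +
      (if does (q e′ ≟ v) then (if does (e ≟ e′) then b else 0#) else 0#) ≈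
      (if does (e ≟ e′) then (if does (p e′ ≟ v) then a else 0#) + (if does (q e′ ≟ v) then b else 0#) else 0#)
    term e′ with e ≟ e′
    ... | yes _ = refl
    ... | no  _ with p e′ ≟ v | q e′ ≟ v
    ... | yes _ | yes _ = +-identityˡ 0#
    ... | yes _ | no _  = +-identityˡ 0#
    ... | no _  | yes _ = +-identityˡ 0#
    ... | no _  | no _  = +-identityˡ 0#
    gate : ∀ u a → (if does (u ≟ v) then a else 0#) ≈ a * δ (vertex u) (vertex v)
    gate u a = trans gate′ (*-congˡ (sym (δ-vertex u v)))
      where
      gate′ : (if does (u ≟ v) then a else 0#) ≈ a * (if does (u ≟ v) then 1# else 0#)
      gate′ with u ≟ v
      ... | yes _ = sym (*-identityʳ a)
      ... | no  _ = sym (zeroʳ a)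

  Piece : (Point → ℝ) → Fin #E → ℝ → ℝ → ℝ → Set
  Piece f e a b m = ∃ λ c → ∀ u → a ≤ val u → val u ≤ b → f (on e u) ≈ c + m * val u

  piece-slope⁺ : ∀ {f e a b m} → Piece f e a b m → b ≤ len e → ∀ t → a ≤ val t → val t < b → Slope⁺ f e t m
  piece-slope⁺ {f} {e} {a} {b} {m} (c , eq) b≤l t a≤t t<b =
    b - val t , 0<y-x t<b , ≤-respˡ (sym t+[b-t]≈b) b≤l , λ u t≤u u≤ →
      lin₂ (eq u (≤-trans a≤t t≤u) (≤-respʳ t+[b-t]≈b u≤)) (eq t a≤t (<⇒≤ t<b))
        (solve 6 (λ fu ft m u t c → fu :- (ft :+ m :* (u :- t)) :=
            :1 :* (fu :- (c :+ m :* u)) :+ (:- :1) :* (ft :- (c :+ m :* t))) refl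
          (f (on e u)) (f (on e t)) m (val u) (val t) c)
    where
    t+[b-t]≈b : val t + (b - val t) ≈ b
    t+[b-t]≈b = solve 2 (λ t b → t :+ (b :- t) := b) refl (val t) b

  piece-slope⁻ : ∀ {f e a b m} → Piece f e a b m → 0# ≤ a → ∀ t → a < val t → val t ≤ b → Slope⁻ f e t (- m)
  piece-slope⁻ {f} {e} {a} {b} {m} (c , eq) 0≤a t a<t t≤b =
    val t - a , 0<y-x a<t , ≤-respʳ (sym t-[t-a]≈a) 0≤a , λ u ≤u u≤t →
      lin₂ (eq u (≤-respˡ t-[t-a]≈a ≤u) (≤-trans u≤t t≤b)) (eq t (<⇒≤ a<t) t≤b)
        (solve 6 (λ fu ft m u t c → fu :- (ft :+ (:- m) :* (t :- u)) :=
            :1 :* (fu :- (c :+ m :* u)) :+ (:- :1) :* (ft :- (c :+ m :* t))) refl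
          (f (on e u)) (f (on e t)) m (val u) (val t) c)
    where
    t-[t-a]≈a : val t - (val t - a) ≈ a
    t-[t-a]≈a = solve 2 (λ t a → t :- (t :- a) := a) refl (val t) a

  module _ (e : Fin #E) where
    L⁻¹ : ℝ
    L⁻¹ = len e ⁻¹

    L*L⁻¹≈1 : len e * L⁻¹ ≈ 1#
    L*L⁻¹≈1 = *-inverseʳ (0<⇒≉0 (0<len e))

  ratio : ∀ e → Segment R (len e) → ℝ
  ratio e t = val t * L⁻¹ e

  ratio-0 : ∀ e t → val t ≈ 0# → ratio e t ≈ 0#
  ratio-0 e t t≈0 = trans (*-congʳ t≈0) (zeroˡ _)

  ratio-1 : ∀ e t → val t ≈ len e → ratio e t ≈ 1#
  ratio-1 e t t≈l = trans (*-congʳ t≈l) (L*L⁻¹≈1 e)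

  -- Green's function of the segment [0, len e] with zero boundary values.
  tent : Fin #E → ℝ → ℝ → ℝ
  tent e t s = (s ⊓ t) - s * t * L⁻¹ e

  -- Extension by zero respects the gluing because `tent` vanishes at both ends of the segment.
  Tent : (e : Fin #E) → Segment R (len e) → Point → ℝ
  Tent e t (vertex _) = 0#
  Tent e t (on e′ s)  = if does (e ≟ e′) then tent e (val t) (val s) else 0#

  tent-cong : ∀ e {t s t′ s′} → t ≈ t′ → s ≈ s′ → tent e t s ≈ tent e t′ s′
  tent-cong e t≈ s≈ = +-cong (⊓-cong s≈ t≈) (-‿cong (*-congʳ (*-cong s≈ t≈)))

  tent-sym : ∀ e t s → tent e t s ≈ tent e s t
  tent-sym e t s = +-cong (⊓-comm s t) (-‿cong (*-congʳ (*-comm s t)))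

  tent-left : ∀ e {t s} → s ≤ t → tent e t s ≈ s - s * t * L⁻¹ e
  tent-left e s≤t = +-congʳ (x≤y⇒x⊓y≈x s≤t)

  tent-right : ∀ e {t s} → t ≤ s → tent e t s ≈ t - s * t * L⁻¹ e
  tent-right e t≤s = +-congʳ (x≤y⇒y⊓x≈x t≤s)

  tent-0 : ∀ e (t : Segment R (len e)) → tent e (val t) 0# ≈ 0#
  tent-0 e t = trans (tent-left e (Segment.0≤val t))
    (solve 2 (λ t i → :0 :- :0 :* t :* i := :0) refl (val t) (L⁻¹ e))

  tent-len : ∀ e (t : Segment R (len e)) → tent e (val t) (len e) ≈ 0#
  tent-len e t = trans (tent-right e (Segment.val≤L t)) (lin₁ (L*L⁻¹≈1 e)
    (solve 3 (λ t l i → (t :- l :* t :* i) :- :0 := (:- t) :* (l :* i :- :1)) refl (val t) (len e) (L⁻¹ e)))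

  Tent-on : ∀ e t s → Tent e t (on e s) ≈ tent e (val t) (val s)
  Tent-on e t s = reflexive (if-same e)

  Tent-off : ∀ e t {e′} s → e ≢ e′ → Tent e t (on e′ s) ≈ 0#
  Tent-off e t s e≢e′ = reflexive (if-differ e≢e′)

  Tent-sym : ∀ e t e′ s → Tent e t (on e′ s) ≈ Tent e′ s (on e t)
  Tent-sym e t e′ s with e ≟ e′
  ... | yes ≡.refl = trans (tent-sym e (val t) (val s)) (sym (Tent-on e s t))
  ... | no e≢e′    = sym (Tent-off e′ s t (e≢e′ ∘ ≡.sym))

  Tent-cong : ∀ e t {x y} → x ≈ₚ y → Tent e t x ≈ Tent e t y
  Tent-cong e t = lift-cong glue
    where
    glue : ∀ {x y} → Glue x y → Tent e t x ≈ Tent e t y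
    glue (same e′ s≈s′) with e ≟ e′
    ... | yes _ = tent-cong e refl s≈s′
    ... | no _  = refl
    glue (start e′ s≈0) with e ≟ e′
    ... | yes _ = trans (tent-cong e refl s≈0) (tent-0 e t)
    ... | no _  = refl
    glue (end e′ s≈l) with e ≟ e′
    ... | yes ≡.refl = trans (tent-cong e refl s≈l) (tent-len e t)
    ... | no _       = refl

  -- Lets the decomposition `k-source` include the end parameters, which `Tent-lap` leaves out.
  Tent-at-end : ∀ e t → val t ≈ 0# ⊎ val t ≈ len e → ∀ x → Tent e t x ≈ 0#
  Tent-at-end e t h     (vertex _) = refl
  Tent-at-end e t (inj₁ t≈0) (on e′ s) with e ≟ e′
  ... | yes ≡.refl = trans (tent-cong e t≈0 refl) (trans (tent-sym e 0# (val s)) (tent-0 e s))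
  ... | no _       = refl
  Tent-at-end e t (inj₂ t≈l) (on e′ s) with e ≟ e′
  ... | yes ≡.refl = trans (tent-cong e t≈l refl) (trans (tent-sym e (len e) (val s)) (tent-len e s))
  ... | no _       = refl

  Tent-left : ∀ e t → Piece (Tent e t) e 0# (val t) (1# - ratio e t)
  Tent-left e t = 0# , λ u _ u≤t → trans (Tent-on e t u) (trans (tent-left e u≤t)
    (solve 3 (λ u t i → u :- u :* t :* i := :0 :+ (:1 :- t :* i) :* u) refl (val u) (val t) (L⁻¹ e)))

  Tent-right : ∀ e t → Piece (Tent e t) e (val t) (len e) (- ratio e t)
  Tent-right e t = val t , λ u t≤u _ → trans (Tent-on e t u) (trans (tent-right e t≤u)
    (solve 3 (λ u t i → t :- u :* t :* i := t :+ (:- (t :* i)) :* u) refl (val u) (val t) (L⁻¹ e)))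

  Tent-elsewhere : ∀ e t {e′} → e ≢ e′ → Piece (Tent e t) e′ 0# (len e′) 0#
  Tent-elsewhere e t {e′} e≢e′ = 0# , λ u _ _ →
    trans (Tent-off e t u e≢e′) (sym (trans (+-identityˡ _) (zeroˡ _)))

  -- The charge of the tent: a unit charge at its peak, balanced by the barycentric
  -- charges at the end points of the edge.
  balanced : (e : Fin #E) → Segment R (len e) → Point → ℝ
  balanced e t x = δ (on e t) x - ((1# - ratio e t) * δ (vertex (p e)) x + ratio e t * δ (vertex (q e)) x)

  Tent-lap : ∀ e t → Interior e t → Lap (Tent e t) (balanced e t)
  Tent-lap e t t-int@(0<t , t<l) = record
    { f-cong = Tent-cong e t ; interior = inner ; atVertex = atV }
    where
    ℓ = ratio e t
    balanced-interior : ∀ {e′ s} → Interior e′ s → balanced e t (on e′ s) ≈ δ (on e t) (on e′ s)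
    balanced-interior s-int =
      lin₂ (δ-off {y = vertex (p e)} (interior≉vertex s-int)) (δ-off {y = vertex (q e)} (interior≉vertex s-int))
      (solve 4 (λ d dp dq l → (d :- ((:1 :- l) :* dp :+ l :* dq)) :- d :=
         (l :- :1) :* (dp :- :0) :+ (:- l) :* (dq :- :0)) refl _ _ _ ℓ)

    straight : ∀ m → - (m + - m) ≈ 0#
    straight = solve 1 (λ m → :- (m :+ :- m) := :0) refl

    inner : ∀ e′ s → Interior e′ s →
      ∃₂ λ s⁺ s⁻ → Slope⁺ (Tent e t) e′ s s⁺ × Slope⁻ (Tent e t) e′ s s⁻ × - (s⁺ + s⁻) ≈ balanced e t (on e′ s)
    inner e′ s s-int@(0<s , s<l) with lem {P = e ≡ e′}
    ... | no e≢e′ = _ , _ ,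
            piece-slope⁺ {Tent e t} (Tent-elsewhere e t e≢e′) ≤-refl s (<⇒≤ 0<s) s<l ,
            piece-slope⁻ {Tent e t} (Tent-elsewhere e t e≢e′) ≤-refl s 0<s (<⇒≤ s<l) ,
            trans (straight 0#) (sym (trans (balanced-interior s-int)
              (δ-off (λ eq → e≢e′ (≡.sym (proj₁ (interior-same s-int eq)))))))
    ... | yes ≡.refl with ≤-dec (val s) (val t) | ≤-dec (val t) (val s)
    ... | no s≰t | _ = _ , _ ,
            piece-slope⁺ {Tent e t} (Tent-right e t) ≤-refl s (<⇒≤ t<s) s<l ,
            piece-slope⁻ {Tent e t} (Tent-right e t) (<⇒≤ 0<t) s t<s (<⇒≤ s<l) ,
            trans (straight (- ℓ)) (sym (trans (balanced-interior s-int)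
              (δ-off (λ eq → s≰t (≤-reflexive (proj₂ (interior-same s-int eq)))))))
      where t<s = ≰⇒> s≰t
    ... | yes s≤t | no t≰s = _ , _ ,
            piece-slope⁺ {Tent e t} (Tent-left e t) (<⇒≤ t<l) s (<⇒≤ 0<s) s<t ,
            piece-slope⁻ {Tent e t} (Tent-left e t) ≤-refl s 0<s s≤t ,
            trans (straight (1# - ℓ)) (sym (trans (balanced-interior s-int)
              (δ-off (λ eq → t≰s (≤-reflexive (sym (proj₂ (interior-same s-int eq))))))))
      where s<t = ≰⇒> t≰s
    -- The only kink: the outgoing slopes - l and - (1 - l) add up to -1, the unit charge at the
    -- peak.
    ... | yes s≤t | yes t≤s = _ , _ ,
            piece-slope⁺ {Tent e t} (Tent-right e t) ≤-refl s t≤s s<l ,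
            piece-slope⁻ {Tent e t} (Tent-left e t) ≤-refl s 0<s s≤t ,
            trans (solve 1 (λ l → :- (:- l :+ :- (:1 :- l)) := :1) refl ℓ)
                  (sym (trans (balanced-interior s-int) (δ-at (return (same e (antisym s≤t t≤s))))))

    s⁺ s⁻ : Fin #E → ℝ
    s⁺ e′ = if does (e ≟ e′) then 1# - ℓ else 0#
    s⁻ e′ = if does (e ≟ e′) then ℓ else 0#

    slopes⁺ : ∀ e′ s → val s ≈ 0# → Slope⁺ (Tent e t) e′ s (s⁺ e′)
    slopes⁺ e′ s s≈0 with lem {P = e ≡ e′}
    ... | yes ≡.refl = Slope⁺-cong {Tent e t} {t = s} (reflexive (≡.sym (if-same e)))
                         (piece-slope⁺ {Tent e t} (Tent-left e t) (<⇒≤ t<l) s (≤-reflexive (sym s≈0))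
                         (≤-<-trans (≤-reflexive s≈0) 0<t))
    ... | no e≢e′    = Slope⁺-cong {Tent e t} {t = s} (reflexive (≡.sym (if-differ e≢e′)))
                         (piece-slope⁺ {Tent e t} (Tent-elsewhere e t e≢e′) ≤-refl s (≤-reflexive (sym s≈0))
                         (≤-<-trans (≤-reflexive s≈0) (0<len e′)))

    slopes⁻ : ∀ e′ s → val s ≈ len e′ → Slope⁻ (Tent e t) e′ s (s⁻ e′)
    slopes⁻ e′ s s≈l with lem {P = e ≡ e′}
    ... | yes ≡.refl = Slope⁻-cong {Tent e t} {t = s}
                         (trans (solve 1 (λ l → :- (:- l) := l) refl ℓ) (reflexive (≡.sym (if-same e))))
                         (piece-slope⁻ {Tent e t} (Tent-right e t) (<⇒≤ 0<t) s
                         (<-≤-trans t<l (≤-reflexive (sym s≈l))) (≤-reflexive s≈l))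
    ... | no e≢e′    = Slope⁻-cong {Tent e t} {t = s} (trans -0#≈0# (reflexive (≡.sym (if-differ e≢e′))))
                         (piece-slope⁻ {Tent e t} (Tent-elsewhere e t e≢e′) ≤-refl s
                         (<-≤-trans (0<len e′) (≤-reflexive (sym s≈l))) (≤-reflexive s≈l))

    atV : ∀ v → ∃₂ λ s⁺ s⁻ →
        (∀ e′ s → val s ≈ 0# → Slope⁺ (Tent e t) e′ s (s⁺ e′)) ×
        (∀ e′ s → val s ≈ len e′ → Slope⁻ (Tent e t) e′ s (s⁻ e′)) × - ∂ s⁺ s⁻ v ≈ balanced e t (vertex v)
    atV v = s⁺ , s⁻ , slopes⁺ , slopes⁻ , (begin
      - ∂ s⁺ s⁻ v ≈⟨ -‿cong (∂-single e (1# - ℓ) ℓ v) ⟩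
      - ((1# - ℓ) * δ (vertex (p e)) (vertex v) + ℓ * δ (vertex (q e)) (vertex v))  ≈⟨ +-identityˡ _ ⟨
      0# - ((1# - ℓ) * δ (vertex (p e)) (vertex v) + ℓ * δ (vertex (q e)) (vertex v))
        ≈⟨ +-congʳ (δ-off (λ eq → interior≉vertex t-int (≈ₚ-sym eq))) ⟨
      balanced e t (vertex v) ∎)

-- The grounded voltage kernel, its symmetry and resistances to points of an edge.

module Resistance (lem : ∀ {ℓ} → ExcludedMiddle ℓ) (R : RealField) (Γ : MetrizedGraph R)
                  (volt : OnGraph.Point lem R Γ → OnGraph.Point lem R Γ → OnGraph.Point lem R Γ → RealField.ℝ R)
                  (V : OnGraph.IsVoltage lem R Γ volt) where
  open RealField R hiding (zero)
  open OnGraph lem R Γ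
  open OrderedField lem R
  open Laplacian lem R Γ
  open Potential lem R Γ
  open Lap
  open SetoidReasoning setoid hiding (start)

  private
    module V = IsVoltage V

  volt-lap : ∀ z y → Lap (λ x → volt z x y) (λ x → δ y x - δ z x)
  volt-lap z y = fromHasLaplacian (V.cong z y) (V.laplacian z y)

  -- Grounding at a vertex puts all charges of `k x (vertex v)` on vertices, so this voltage is
  -- affine on each edge.
  base : Fin #V
  base = pick #V nonEmpty
    where
    pick : ∀ n → n ≢ 0 → Fin n
    pick zero    n≢0 = contradiction ≡.refl n≢0
    pick (suc n) _   = zero

  k : Point → Point → ℝ
  k x y = volt (vertex base) x y

  k-lap : ∀ y → Lap (λ x → k x y) (λ x → δ y x - δ (vertex base) x)
  k-lap = volt-lap (vertex base)

  k-base : ∀ y → k (vertex base) y ≈ 0#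
  k-base = V.grounded (vertex base)

  -- As functions of `x`, both sides have Laplacian δ_y - δ_z, the charges at `base` cancelling, and
  -- both vanish at `x = z`.
  volt-k : ∀ z x y → volt z x y ≈ (k x y - k x z) - (k z y - k z z)
  volt-k z x y = lin₂ (lap-unique (volt-lap z y) (lap-resp cancel-base (lap-lin 1# (- 1#) (k-lap y) (k-lap z))) x z)
      (V.grounded z y)
      (solve 6 (λ vx kxy kxz vz kzy kzz → vx :- ((kxy :- kxz) :- (kzy :- kzz)) :=
         :1 :* ((vx :- (:1 :* kxy :+ :- :1 :* kxz)) :- (vz :- (:1 :* kzy :+ :- :1 :* kzz)))
         :+ :1 :* (vz :- :0)) refl (volt z x y) (k x y) (k x z) (volt z z y) (k z y) (k z z))
    where
    cancel-base : ∀ x → 1# * (δ y x - δ (vertex base) x) + - 1# * (δ z x - δ (vertex base) x) ≈ δ y x - δ z x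
    cancel-base x = solve 3 (λ a b c → :1 :* (a :- c) :+ :- :1 :* (b :- c) := a :- b) refl
                      (δ y x) (δ z x) (δ (vertex base) x)

  -- `IsVoltage` states invariance under gluing for the field point only; for the source it follows
  -- from uniqueness, as glued sources have the same Dirac measure.
  k-congʳ : ∀ x {y y′} → y ≈ₚ y′ → k x y ≈ k x y′
  k-congʳ x {y} {y′} y≈y′ = lin₃
      (lap-unique (k-lap y) (lap-resp (λ x → +-congʳ (sym (δ-cong y≈y′ x))) (k-lap y′)) x (vertex base))
      (k-base y) (k-base y′)
      (solve 4 (λ a b c d → a :- b := :1 :* ((a :- b) :- (c :- d)) :+ :1 :* (c :- :0) :+ :- :1 :* (d :- :0))
        refl (k x y) (k x y′) (k (vertex base) y) (k (vertex base) y′))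

  k-source : ∀ x e t → k x (on e t) ≈
    (1# - ratio e t) * k x (vertex (p e)) + ratio e t * k x (vertex (q e)) + Tent e t x
  k-source x e t with interior-or-end e t
  ... | inj₂ (inj₁ t≈0) = lin₃ (k-congʳ x (return (start e t≈0))) (ratio-0 e t t≈0) (Tent-at-end e t (inj₁ t≈0) x)
      (solve 5 (λ ky kp kq l T → ky :- ((:1 :- l) :* kp :+ l :* kq :+ T) :=
         :1 :* (ky :- kp) :+ (kp :- kq) :* (l :- :0) :+ :- :1 :* (T :- :0)) refl
        (k x (on e t)) (k x (vertex (p e))) (k x (vertex (q e))) (ratio e t) (Tent e t x))
  ... | inj₂ (inj₂ t≈l) = lin₃ (k-congʳ x (return (end e t≈l))) (ratio-1 e t t≈l) (Tent-at-end e t (inj₂ t≈l) x)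
      (solve 5 (λ ky kp kq l T → ky :- ((:1 :- l) :* kp :+ l :* kq :+ T) :=
         :1 :* (ky :- kq) :+ (kp :- kq) :* (l :- :1) :+ :- :1 :* (T :- :0)) refl
        (k x (on e t)) (k x (vertex (p e))) (k x (vertex (q e))) (ratio e t) (Tent e t x))
  ... | inj₁ t-int = x-y≈0⇒x≈y (trans (trans
        (solve 5 (λ ky kp kq l T → ky :- ((:1 :- l) :* kp :+ l :* kq :+ T) :=
           (:1 :* ky :+ :- :1 :* T) :- ((:1 :- l) :* kp :+ l :* kq)) refl _ _ _ ℓ _)
        (lap-unique lap-left lap-right x (vertex base)))
      (lin₃ (k-base (on e t)) (k-base (vertex (p e))) (k-base (vertex (q e)))
        (solve 4 (λ l a b c → ((:1 :* a :+ :- :1 :* :0) :- ((:1 :- l) :* b :+ l :* c)) :- :0 :=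
           :1 :* (a :- :0) :+ (l :- :1) :* (b :- :0) :+ (:- l) :* (c :- :0)) refl ℓ _ _ _)))
    where
    ℓ = ratio e t
    δb = δ (vertex base)
    -- The common Laplacian of both sides: subtracting the tent replaces the charge at `on e t` by
    -- its barycentric split over the end points.
    mixture : Point → ℝ
    mixture x = ((1# - ℓ) * δ (vertex (p e)) x + ℓ * δ (vertex (q e)) x) - δb x
    lap-left : Lap (λ x → 1# * k x (on e t) + - 1# * Tent e t x) mixture
    lap-left = lap-resp (λ x → solve 3 (λ d m b → :1 :* (d :- b) :+ :- :1 :* (d :- m) := m :- b) refl
                          (δ (on e t) x) _ (δb x))
                 (lap-lin 1# (- 1#) (k-lap (on e t)) (Tent-lap e t t-int))
    lap-right : Lap (λ x → (1# - ℓ) * k x (vertex (p e)) + ℓ * k x (vertex (q e))) mixture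
    lap-right = lap-resp (λ x → solve 4 (λ l a c b → (:1 :- l) :* (a :- b) :+ l :* (c :- b)
                                          := ((:1 :- l) :* a :+ l :* c) :- b) refl ℓ _ _ (δb x))
                 (lap-lin (1# - ℓ) ℓ (k-lap (vertex (p e))) (k-lap (vertex (q e))))

  k-affine : ∀ e v → ∃ (AffineOn (λ x → k x (vertex v)) e)
  k-affine e v = edge-affine (k-lap (vertex v)) e λ t t-int →
    trans (+-cong (δ-off (interior≉vertex t-int)) (-‿cong (δ-off (interior≉vertex t-int)))) (-‿inverseʳ 0#)

  -- A vertex source makes the voltage affine on `e`, so the field point interpolates with the
  -- weights that `k-source` gives to the source. This match reduces symmetry to vertices.
  k-field : ∀ e s v → k (on e s) (vertex v) ≈
    (1# - ratio e s) * k (vertex (p e)) (vertex v) + ratio e s * k (vertex (q e)) (vertex v)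
  k-field e s v = lin₃ (aff s) (ends-affine (k-lap (vertex v)) aff) (L*L⁻¹≈1 e)
    (solve 7 (λ ks kp kq m s l i → ks :- ((:1 :- s :* i) :* kp :+ (s :* i) :* kq) :=
        :1 :* (ks :- (kp :+ m :* s)) :+ :- (s :* i) :* (kq :- (kp :+ m :* l)) :+ :- (m :* s) :* (l :* i :- :1)) refl
      _ _ _ m (val s) (len e) (L⁻¹ e))
    where
    m = proj₁ (k-affine e v)
    aff = proj₂ (k-affine e v)

  k-sym-vertex : ∀ u w → k (vertex u) (vertex w) ≈ k (vertex w) (vertex u)
  k-sym-vertex u w = begin
    k (vertex u) (vertex w)     ≈⟨ pairing w u ⟨
    ∑[ v < #V ] (k (vertex v) (vertex w) * (δ (vertex u) (vertex v) - δ (vertex base) (vertex v)))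
      ≈⟨ green-pairing (k-lap (vertex w)) (k-lap (vertex u)) (λ e → proj₂ (k-affine e w)) (λ e → proj₂ (k-affine e u)) ⟩
    ∑[ e < #E ] (m w e * m u e * len e)  ≈⟨ R-sum.sum-cong-≋ (λ e → *-congʳ (*-comm (m w e) (m u e))) ⟩
    ∑[ e < #E ] (m u e * m w e * len e)
      ≈⟨ green-pairing (k-lap (vertex u)) (k-lap (vertex w)) (λ e → proj₂ (k-affine e u)) (λ e → proj₂ (k-affine e w)) ⟨
    ∑[ v < #V ] (k (vertex v) (vertex u) * (δ (vertex w) (vertex v) - δ (vertex base) (vertex v)))
      ≈⟨ pairing u w ⟩
    k (vertex w) (vertex u)     ∎
    where
    m : Fin #V → Fin #E → ℝ
    m v e = proj₁ (k-affine e v)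
    weigh : ∀ (φ : Fin #V → ℝ) u → ∑[ v < #V ] (φ v * δ (vertex u) (vertex v)) ≈ φ u
    weigh φ u = trans (R-sum.sum-cong-≋ term) (sum-single u φ)
      where
      term : ∀ v → φ v * δ (vertex u) (vertex v) ≈ (if does (u ≟ v) then φ v else 0#)
      term v = trans (*-congˡ (δ-vertex u v)) gate
        where
        gate : φ v * (if does (u ≟ v) then 1# else 0#) ≈ (if does (u ≟ v) then φ v else 0#)
        gate with u ≟ v
        ... | yes _ = *-identityʳ _
        ... | no  _ = zeroʳ _
    -- Pairing with δ_u - δ_base evaluates at `u`, since the kernel vanishes at `base`.
    pairing : ∀ w u → ∑[ v < #V ] (k (vertex v) (vertex w) * (δ (vertex u) (vertex v) - δ (vertex base) (vertex v)))
                      ≈ k (vertex u) (vertex w)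
    pairing w u = begin
      _ ≈⟨ R-sum.sum-cong-≋ (λ v → solve 3 (λ a b c → a :* (b :- c) := a :* b :+ (:- :1) :* (a :* c)) refl (φ v) _ _) ⟩
      ∑[ v < #V ] (A v + - 1# * B v)                        ≈⟨ R-sum.∑-distrib-+ A (λ v → - 1# * B v) ⟩
      ∑[ v < #V ] A v + ∑[ v < #V ] (- 1# * B v)            ≈⟨ +-congˡ (R-sum.*-distribˡ-sum (- 1#) B) ⟨
      ∑[ v < #V ] A v + - 1# * ∑[ v < #V ] B v
        ≈⟨ +-cong (weigh φ u) (*-congˡ (trans (weigh φ base) (k-base (vertex w)))) ⟩
      φ u + - 1# * 0#                                       ≈⟨ solve 1 (λ a → a :+ (:- :1) :* :0 := a) refl (φ u) ⟩
      φ u ∎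
      where
      φ A B : Fin #V → ℝ
      φ v = k (vertex v) (vertex w)
      A v = φ v * δ (vertex u) (vertex v)
      B v = φ v * δ (vertex base) (vertex v)

  k-sym-mixed : ∀ u e t → k (vertex u) (on e t) ≈ k (on e t) (vertex u)
  k-sym-mixed u e t = begin
    k (vertex u) (on e t)
      ≈⟨ k-source (vertex u) e t ⟩
    (1# - ℓ) * k (vertex u) (vertex (p e)) + ℓ * k (vertex u) (vertex (q e)) + 0#
      ≈⟨ +-identityʳ _ ⟩
    (1# - ℓ) * k (vertex u) (vertex (p e)) + ℓ * k (vertex u) (vertex (q e))
      ≈⟨ +-cong (*-congˡ (k-sym-vertex u (p e))) (*-congˡ (k-sym-vertex u (q e))) ⟩
    (1# - ℓ) * k (vertex (p e)) (vertex u) + ℓ * k (vertex (q e)) (vertex u)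
      ≈⟨ k-field e t u ⟨
    k (on e t) (vertex u) ∎
    where ℓ = ratio e t

  -- For two edge points, `k-source` and `k-field` give a bilinear form in the four values at the
  -- end points plus a tent, and each of these is symmetric.
  k-sym : ∀ x y → k x y ≈ k y x
  k-sym (vertex u) (vertex w) = k-sym-vertex u w
  k-sym (vertex u) (on e t)   = k-sym-mixed u e t
  k-sym (on e t)   (vertex w) = sym (k-sym-mixed w e t)
  k-sym (on e′ s)  (on e t)   = begin
    k (on e′ s) (on e t)
      ≈⟨ k-source (on e′ s) e t ⟩
    (1# - ℓ) * k (on e′ s) P + ℓ * k (on e′ s) Q + Tent e t (on e′ s)
      ≈⟨ +-cong (+-cong (*-congˡ (k-field e′ s (p e))) (*-congˡ (k-field e′ s (q e)))) (Tent-sym e t e′ s) ⟩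
    (1# - ℓ) * ((1# - κ) * k P′ P + κ * k Q′ P) + ℓ * ((1# - κ) * k P′ Q + κ * k Q′ Q) + T
      ≈⟨ solve 7 (λ l κ a b c d T →
            (:1 :- l) :* ((:1 :- κ) :* a :+ κ :* b) :+ l :* ((:1 :- κ) :* c :+ κ :* d) :+ T :=
            (:1 :- κ) :* ((:1 :- l) :* a :+ l :* c) :+ κ :* ((:1 :- l) :* b :+ l :* d) :+ T) refl
            ℓ κ (k P′ P) (k Q′ P) (k P′ Q) (k Q′ Q) T ⟩
    (1# - κ) * ((1# - ℓ) * k P′ P + ℓ * k P′ Q) + κ * ((1# - ℓ) * k Q′ P + ℓ * k Q′ Q) + T
      ≈⟨ +-congʳ (+-cong (*-congˡ (swap (p e′))) (*-congˡ (swap (q e′)))) ⟩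
    (1# - κ) * k (on e t) P′ + κ * k (on e t) Q′ + T
      ≈⟨ k-source (on e t) e′ s ⟨
    k (on e t) (on e′ s) ∎
    where
    ℓ = ratio e t
    κ = ratio e′ s
    T = Tent e′ s (on e t)
    P  = vertex (p e)
    Q  = vertex (q e)
    P′ = vertex (p e′)
    Q′ = vertex (q e′)
    swap : ∀ v → (1# - ℓ) * k (vertex v) P + ℓ * k (vertex v) Q ≈ k (on e t) (vertex v)
    swap v = trans (+-cong (*-congˡ (k-sym-vertex v (p e))) (*-congˡ (k-sym-vertex v (q e)))) (sym (k-field e t v))

  r : Point → Point → ℝ
  r = resistance volt

  r-k : ∀ x y → r x y ≈ (k x x + k y y) - (k x y + k x y)
  r-k x y = trans (volt-k y x x) (lin₁ (k-sym y x)
    (solve 4 (λ xx xy yx yy → ((xx :- xy) :- (yx :- yy)) :- ((xx :+ yy) :- (xy :+ xy)) := :- :1 :* (yx :- xy)) refl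
      (k x x) (k x y) (k y x) (k y y)))

  r-sym : ∀ x y → r x y ≈ r y x
  r-sym x y = trans (r-k x y) (trans (lin₁ (k-sym x y)
    (solve 4 (λ xx xy yx yy → ((xx :+ yy) :- (xy :+ xy)) :- ((yy :+ xx) :- (yx :+ yx)) := (:- (:1 :+ :1)) :* (xy :- yx)) refl
      (k x x) (k x y) (k y x) (k y y))) (sym (r-k y x)))

  volt-r : ∀ z x y → volt z x y ≈ ½ * ((r x z + r y z) - r x y)
  volt-r z x y = halve (trans (+-cong (volt-k z x y) (volt-k z x y)) (trans
    (lin₂ (k-sym y z) (refl {0#})
       (solve 7 (λ xx yy zz xy xz zy yz →
          (((xy :- xz) :- (zy :- zz)) :+ ((xy :- xz) :- (zy :- zz)))
          :- (((((xx :+ zz) :- (xz :+ xz)) :+ ((yy :+ zz) :- (yz :+ yz))) :- ((xx :+ yy) :- (xy :+ xy))))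
          := (:1 :+ :1) :* (yz :- zy) :+ :0 :* (:0 :- :0)) refl
        (k x x) (k y y) (k z z) (k x y) (k x z) (k z y) (k y z)))
    (sym (+-cong (+-cong (r-k x z) (r-k y z)) (-‿cong (r-k x y))))))

  -- Satisfied by vertices and by points of other edges. At such a point `k-source` has no tent
  -- term, which is the form in which `r-edge` uses it.
  Off : Fin #E → Point → Set
  Off e a = ∀ t → Tent e t a ≈ 0#

  -- In `r-k` the cross term `k a y` is affine in the ratio. The diagonal `k y y` interpolates
  -- twice, which costs the product of the weights times `r P Q`, and its tent peak adds the same
  -- product times `len e`.
  r-edge : ∀ e t {a} → Off e a → r a (on e t) ≈
    (1# - ratio e t) * r a (vertex (p e)) + ratio e t * r a (vertex (q e))
    + ratio e t * (1# - ratio e t) * (len e - r (vertex (p e)) (vertex (q e)))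
  r-edge e t {a} off = begin
    r a y                        ≈⟨ r-k a y ⟩
    (k a a + k y y) - (k a y + k a y)
      ≈⟨ +-cong (+-congˡ yy) (-‿cong (+-cong ay ay)) ⟩
    (k a a + ((1# - ℓ) * ((1# - ℓ) * k P P + ℓ * k Q P) + ℓ * ((1# - ℓ) * k P Q + ℓ * k Q Q) + len e * (ℓ * (1# - ℓ))))
      - (((1# - ℓ) * k a P + ℓ * k a Q) + ((1# - ℓ) * k a P + ℓ * k a Q))
      ≈⟨ lin₁ (k-sym Q P) (solve 9 (λ l aa PP QP PQ QQ aP aQ L →
           ((aa :+ ((:1 :- l) :* ((:1 :- l) :* PP :+ l :* QP) :+ l :* ((:1 :- l) :* PQ :+ l :* QQ) :+ L :* (l :* (:1 :- l))))
            :- (((:1 :- l) :* aP :+ l :* aQ) :+ ((:1 :- l) :* aP :+ l :* aQ)))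
           :- ((:1 :- l) :* ((aa :+ PP) :- (aP :+ aP)) :+ l :* ((aa :+ QQ) :- (aQ :+ aQ))
               :+ l :* (:1 :- l) :* (L :- ((PP :+ QQ) :- (PQ :+ PQ))))
           := (l :* (:1 :- l)) :* (QP :- PQ)) refl
           ℓ (k a a) (k P P) (k Q P) (k P Q) (k Q Q) (k a P) (k a Q) (len e)) ⟩
    (1# - ℓ) * ((k a a + k P P) - (k a P + k a P)) + ℓ * ((k a a + k Q Q) - (k a Q + k a Q))
      + ℓ * (1# - ℓ) * (len e - ((k P P + k Q Q) - (k P Q + k P Q)))
      ≈⟨ +-cong (+-cong (*-congˡ (r-k a P)) (*-congˡ (r-k a Q))) (*-congˡ (+-congˡ (-‿cong (r-k P Q)))) ⟨
    (1# - ℓ) * r a P + ℓ * r a Q + ℓ * (1# - ℓ) * (len e - r P Q) ∎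
    where
    ℓ = ratio e t
    y = on e t
    P = vertex (p e)
    Q = vertex (q e)
    peak : Tent e t y ≈ len e * (ℓ * (1# - ℓ))
    peak = trans (Tent-on e t t) (trans (tent-left e ≤-refl) (lin₁ (L*L⁻¹≈1 e)
      (solve 3 (λ t l i → (t :- t :* t :* i) :- l :* (t :* i :* (:1 :- t :* i)) := (t :* t :* i :- t) :* (l :* i :- :1))
        refl (val t) (len e) (L⁻¹ e))))
    yy : k y y ≈ (1# - ℓ) * ((1# - ℓ) * k P P + ℓ * k Q P) + ℓ * ((1# - ℓ) * k P Q + ℓ * k Q Q) + len e * (ℓ * (1# - ℓ))
    yy = trans (k-source y e t) (+-cong (+-cong (*-congˡ (k-field e t (p e))) (*-congˡ (k-field e t (q e)))) peak)
    ay : k a y ≈ (1# - ℓ) * k a P + ℓ * k a Q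
    ay = trans (k-source a e t) (trans (+-congˡ (off t)) (+-identityʳ _))

  -- The vertex values contribute the squared difference of the ratios times `r P Q`, and the tents
  -- contribute `val s - val t` less that square times `len e`. The order of `s` and `t` resolves
  -- the minimum in the mixed tent.
  r-same-edge : ∀ e s t → val t ≤ val s →
    r (on e s) (on e t) ≈ (val s - val t) +
      (ratio e s - ratio e t) * (ratio e s - ratio e t) * (r (vertex (p e)) (vertex (q e)) - len e)
  r-same-edge e s t t≤s = begin
    r x y   ≈⟨ r-k x y ⟩
    (k x x + k y y) - (k x y + k x y)
      ≈⟨ +-cong (+-cong (expand s s) (expand t t)) (-‿cong (+-cong (expand s t) (expand s t))) ⟩
    (K κ κ (Tent e s x) + K ℓ ℓ (Tent e t y)) - (K κ ℓ (Tent e t x) + K κ ℓ (Tent e t x))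
      ≈⟨ lin₂ (k-sym Q P) tents (solve 11 (λ l κ PP QP PQ QQ Tx Ty Txy d L →
          ((((:1 :- κ) :* ((:1 :- κ) :* PP :+ κ :* QP) :+ κ :* ((:1 :- κ) :* PQ :+ κ :* QQ) :+ Tx)
          :+ ((:1 :- l) :* ((:1 :- l) :* PP :+ l :* QP) :+ l :* ((:1 :- l) :* PQ :+ l :* QQ) :+ Ty))
          :- (((:1 :- l) :* ((:1 :- κ) :* PP :+ κ :* QP) :+ l :* ((:1 :- κ) :* PQ :+ κ :* QQ) :+ Txy)
          :+ ((:1 :- l) :* ((:1 :- κ) :* PP :+ κ :* QP) :+ l :* ((:1 :- κ) :* PQ :+ κ :* QQ) :+ Txy)))
          :- (d :+ (κ :- l) :* (κ :- l) :* (((PP :+ QQ) :- (PQ :+ PQ)) :- L))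
          := (κ :* (:1 :- κ) :+ l :* (:1 :- l) :- (κ :* (:1 :- l) :+ κ :* (:1 :- l))) :* (QP :- PQ)
             :+ :1 :* (((Tx :+ Ty) :- (Txy :+ Txy)) :- (d :- (κ :- l) :* (κ :- l) :* L))) refl
          ℓ κ (k P P) (k Q P) (k P Q) (k Q Q) (Tent e s x) (Tent e t y) (Tent e t x) (val s - val t) (len e)) ⟩
    (val s - val t) + (κ - ℓ) * (κ - ℓ) * (((k P P + k Q Q) - (k P Q + k P Q)) - len e)
      ≈⟨ +-congˡ (*-congˡ (+-congʳ (r-k P Q))) ⟨
    (val s - val t) + (κ - ℓ) * (κ - ℓ) * (r P Q - len e) ∎
    where
    x = on e s
    y = on e t
    κ = ratio e s
    ℓ = ratio e t
    P = vertex (p e)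
    Q = vertex (q e)
    K : ℝ → ℝ → ℝ → ℝ
    K κ ℓ T = (1# - ℓ) * ((1# - κ) * k P P + κ * k Q P) + ℓ * ((1# - κ) * k P Q + κ * k Q Q) + T
    expand : ∀ s t → k (on e s) (on e t) ≈ K (ratio e s) (ratio e t) (Tent e t (on e s))
    expand s t = trans (k-source (on e s) e t)
      (+-congʳ (+-cong (*-congˡ (k-field e s (p e))) (*-congˡ (k-field e s (q e)))))
    tents : (Tent e s x + Tent e t y) - (Tent e t x + Tent e t x) ≈ (val s - val t) - (κ - ℓ) * (κ - ℓ) * len e
    tents = trans (+-cong (+-cong (trans (Tent-on e s s) (tent-left e ≤-refl)) (trans (Tent-on e t t) (tent-left e ≤-refl)))
                          (-‿cong (+-cong peak peak)))
      (lin₁ (L*L⁻¹≈1 e) (solve 4 (λ s t i l →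
         (((s :- s :* s :* i) :+ (t :- t :* t :* i)) :- ((t :- s :* t :* i) :+ (t :- s :* t :* i)))
         :- ((s :- t) :- (s :* i :- t :* i) :* (s :* i :- t :* i) :* l)
         := ((s :- t) :* (s :- t) :* i) :* (l :* i :- :1)) refl (val s) (val t) (L⁻¹ e) (len e)))
      where
      peak : Tent e t x ≈ val t - val s * val t * L⁻¹ e
      peak = trans (Tent-on e t s) (tent-right e t≤s)

-- Resistances along bridges.

module Bridges (lem : ∀ {ℓ} → ExcludedMiddle ℓ) (R : RealField) (Γ : MetrizedGraph R)
               (volt : OnGraph.Point lem R Γ → OnGraph.Point lem R Γ → OnGraph.Point lem R Γ → RealField.ℝ R)
               (V : OnGraph.IsVoltage lem R Γ volt) where
  open RealField R hiding (zero)
  open OnGraph lem R Γ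
  open OrderedField lem R
  open Laplacian lem R Γ
  open Potential lem R Γ
  open Resistance lem R Γ volt V
  open SetoidReasoning setoid hiding (start)

  side : Fin #E → Fin #V → ℝ
  side e v = if does (lem {P = Joined-minus e (p e) v}) then 0# else len e

  Ramp : Fin #E → Point → ℝ
  Ramp e (vertex v) = side e v
  Ramp e (on e′ t)  = if does (e ≟ e′) then val t else side e (p e′)

  Ramp-off : ∀ e {e′} t → e ≢ e′ → Ramp e (on e′ t) ≈ side e (p e′)
  Ramp-off e t e≢e′ = reflexive (if-differ e≢e′)

  side-cong : ∀ e {u v} → Joined-minus e u v → side e u ≈ side e v
  side-cong e {u} {v} u~v with lem {P = Joined-minus e (p e) u} | lem {P = Joined-minus e (p e) v}
  ... | yes _ | yes _ = refl
  ... | no _  | no _  = refl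
  ... | yes a | no b  = contradiction (EqC.transitive _ a u~v) b
  ... | no a  | yes b = contradiction (EqC.transitive _ b (EqC.symmetric _ u~v)) a

  side-p : ∀ e → side e (p e) ≈ 0#
  side-p e with lem {P = Joined-minus e (p e) (p e)}
  ... | yes _ = refl
  ... | no ¬h = contradiction (EqC.reflexive _) ¬h

  InComponent-resp : ∀ {e a x y} → x ≈ₚ y → InComponent e a x → InComponent e a y
  InComponent-resp x≈y (inj₁ (v , x≈v , a~v)) = inj₁ (v , ≈ₚ-trans (≈ₚ-sym x≈y) x≈v , a~v)
  InComponent-resp x≈y (inj₂ (e′ , e′≢e , (t , x≈t) , a~v)) =
    inj₂ (e′ , e′≢e , (t , ≈ₚ-trans (≈ₚ-sym x≈y) x≈t) , a~v)

  module _ {e : Fin #E} (bridge : IsBridge e) where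
    private
      P Q : Point
      P = vertex (p e)
      Q = vertex (q e)

    -- `IsBridge` does not mention end points. Were they joined off `e`, that path could replace `e`
    -- wherever a path uses it, and all vertices would be joined off `e`.
    p≁q : ¬ Joined-minus e (p e) (q e)
    p≁q p~q = bridge λ u v → gfold (EqC.isEquivalence _) (λ v → v) detour (connected u v)
      where
      detour : ∀ {u v} → Link p q _ u v → Joined-minus e u v
      detour (link e′ _) with lem {P = e′ ≡ e}
      ... | yes ≡.refl = p~q
      ... | no e′≢e    = return (link e′ e′≢e)

    side-q : side e (q e) ≈ len e
    side-q with lem {P = Joined-minus e (p e) (q e)}
    ... | yes p~q = contradiction p~q p≁q
    ... | no _    = refl

    Ramp-cong : ∀ {x y} → x ≈ₚ y → Ramp e x ≈ Ramp e y
    Ramp-cong = lift-cong glue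
      where
      glue : ∀ {x y} → Glue x y → Ramp e x ≈ Ramp e y
      glue (same e′ s≈t) with e ≟ e′
      ... | yes _ = s≈t
      ... | no _  = refl
      glue (start e′ t≈0) with e ≟ e′
      ... | yes ≡.refl = trans t≈0 (sym (side-p e))
      ... | no _       = refl
      glue (end e′ t≈l) with e ≟ e′
      ... | yes ≡.refl = trans t≈l (sym side-q)
      ... | no e≢e′    = side-cong e (return (link e′ (e≢e′ ∘ ≡.sym)))

    Ramp-piece : ∀ e′ → Piece (Ramp e) e′ 0# (len e′) (if does (e ≟ e′) then 1# else 0#)
    Ramp-piece e′ with e ≟ e′
    ... | yes _ = 0# , λ u _ _ → solve 1 (λ u → u := :0 :+ :1 :* u) refl (val u)
    ... | no _  = side e (p e′) , λ u _ _ → solve 2 (λ s u → s := s :+ :0 :* u) refl _ (val u)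

    Ramp-lap : Lap (Ramp e) (λ x → δ Q x - δ P x)
    Ramp-lap = record
      { f-cong = Ramp-cong
      ; interior = λ e′ t t-int@(0<t , t<l) → _ , _ ,
          piece-slope⁺ {Ramp e} (Ramp-piece e′) ≤-refl t (<⇒≤ 0<t) t<l ,
          piece-slope⁻ {Ramp e} (Ramp-piece e′) ≤-refl t 0<t (<⇒≤ t<l) ,
          lin₂ (δ-off {y = Q} (interior≉vertex t-int)) (δ-off {y = P} (interior≉vertex t-int))
            (solve 3 (λ m a b → :- (m :+ :- m) :- (a :- b) := (:- :1) :* (a :- :0) :+ :1 :* (b :- :0)) refl _ _ _)
      ; atVertex = λ v →
          (λ e′ → if does (e ≟ e′) then 1# else 0#) , (λ e′ → if does (e ≟ e′) then - 1# else 0#) ,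
          (λ e′ t t≈0 → piece-slope⁺ {Ramp e} (Ramp-piece e′) ≤-refl t (≤-reflexive (sym t≈0))
                          (≤-<-trans (≤-reflexive t≈0) (0<len e′))) ,
          (λ e′ t t≈l → Slope⁻-cong {Ramp e} {t = t} (negate e′)
                          (piece-slope⁻ {Ramp e} (Ramp-piece e′) ≤-refl t
                            (<-≤-trans (0<len e′) (≤-reflexive (sym t≈l))) (≤-reflexive t≈l))) ,
          trans (-‿cong (∂-single e 1# (- 1#) v))
            (solve 2 (λ a b → :- (:1 :* a :+ :- :1 :* b) := b :- a) refl (δ P (vertex v)) (δ Q (vertex v)))
      }
      where
      negate : ∀ e′ → - (if does (e ≟ e′) then 1# else 0#) ≈ (if does (e ≟ e′) then - 1# else 0#)
      negate e′ with e ≟ e′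
      ... | yes _ = refl
      ... | no _  = -0#≈0#

    volt-bridge : ∀ x → volt P x Q ≈ Ramp e x
    volt-bridge x = lin₃ (lap-unique (volt-lap P Q) Ramp-lap x P) (IsVoltage.grounded V P Q) (side-p e)
      (solve 4 (λ a b c d → a :- b := :1 :* ((a :- b) :- (c :- d)) :+ :1 :* (c :- :0) :+ :- :1 :* (d :- :0))
        refl (volt P x Q) (Ramp e x) (volt P P Q) (side e (p e)))

    r-bridge : r P Q ≈ len e
    r-bridge = trans (r-sym P Q) (trans (volt-bridge Q) side-q)

    -- Both sides are twice the voltage j_P(x, Q).
    r-difference : ∀ x → (r x P + len e) - r x Q ≈ Ramp e x + Ramp e x
    r-difference x = trans (sym (double-half _)) (+-cong half half)
      where
      half : ½ * ((r x P + len e) - r x Q) ≈ Ramp e x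
      half = trans (*-congˡ (+-congʳ (+-congˡ (sym (trans (r-sym Q P) r-bridge)))))
                   (trans (sym (volt-r P x Q)) (volt-bridge x))

    component-Ramp : ∀ {a x} → InComponent e a x → Ramp e x ≈ side e a
    component-Ramp (inj₁ (v , x≈v , a~v)) = trans (Ramp-cong x≈v) (sym (side-cong e a~v))
    component-Ramp (inj₂ (e′ , e′≢e , (t , x≈t) , a~v)) =
      trans (Ramp-cong x≈t) (trans (Ramp-off e t (e′≢e ∘ ≡.sym)) (sym (side-cong e a~v)))

    -- Since `r P Q` is `len e`, the quadratic term of `r-edge` disappears. The ramp is 0 at `a`, so
    -- `r-difference` gives `r a Q` as `r a P + len e`, and the interpolation becomes `r a P` plus
    -- the parameter. In `r-from-q` the ramp is `len e` and the end points change places.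
    r-from-p : ∀ {a} → Off e a → InComponent e (p e) a → ∀ x → r (on e x) a ≈ val x + r P a
    r-from-p {a} off a∈p x = begin
      r (on e x) a   ≈⟨ r-sym (on e x) a ⟩
      r a (on e x)   ≈⟨ r-edge e x off ⟩
      (1# - ℓ) * r a P + ℓ * r a Q + ℓ * (1# - ℓ) * (len e - r P Q)
        ≈⟨ lin₃ (trans (r-difference a) (trans (+-cong Ramp≈0 Ramp≈0) (+-identityˡ 0#))) r-bridge (L*L⁻¹≈1 e)
           (solve 6 (λ x i A B D L → ((:1 :- x :* i) :* A :+ (x :* i) :* B :+ (x :* i) :* (:1 :- x :* i) :* (L :- D))
               :- (x :+ A) := (:- (x :* i)) :* (((A :+ L) :- B) :- :0) :+ (:- ((x :* i) :* (:1 :- x :* i))) :* (D :- L)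
                  :+ x :* (L :* i :- :1)) refl
             (val x) (L⁻¹ e) (r a P) (r a Q) (r P Q) (len e)) ⟩
      val x + r a P  ≈⟨ +-congˡ (r-sym a P) ⟩
      val x + r P a  ∎
      where
      ℓ = ratio e x
      Ramp≈0 = trans (component-Ramp a∈p) (side-p e)

    r-from-q : ∀ {a} → Off e a → InComponent e (q e) a → ∀ x → r (on e x) a ≈ (len e - val x) + r Q a
    r-from-q {a} off a∈q x = begin
      r (on e x) a   ≈⟨ r-sym (on e x) a ⟩
      r a (on e x)   ≈⟨ r-edge e x off ⟩
      (1# - ℓ) * r a P + ℓ * r a Q + ℓ * (1# - ℓ) * (len e - r P Q)
        ≈⟨ lin₃ (trans (r-difference a) (+-cong Ramp≈l Ramp≈l)) r-bridge (L*L⁻¹≈1 e)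
           (solve 6 (λ x i A B D L → ((:1 :- x :* i) :* A :+ (x :* i) :* B :+ (x :* i) :* (:1 :- x :* i) :* (L :- D))
               :- ((L :- x) :+ B) := (:1 :- x :* i) :* (((A :+ L) :- B) :- (L :+ L)) :+ (:- ((x :* i) :* (:1 :- x :* i))) :* (D :- L)
                  :+ (:- x) :* (L :* i :- :1)) refl
             (val x) (L⁻¹ e) (r a P) (r a Q) (r P Q) (len e)) ⟩
      (len e - val x) + r a Q  ≈⟨ +-congˡ (r-sym a Q) ⟩
      (len e - val x) + r Q a  ∎
      where
      ℓ = ratio e x
      Ramp≈l = trans (component-Ramp a∈q) side-q

    r-bridge-≤ : ∀ s t → val t ≤ val s → r (on e s) (on e t) ≈ val s - val t
    r-bridge-≤ s t t≤s = trans (r-same-edge e s t t≤s)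
      (trans (+-congˡ (trans (*-congˡ (x≈y⇒x-y≈0 r-bridge)) (zeroʳ _))) (+-identityʳ _))

    r-on-bridge : ∀ s t → r (on e s) (on e t) ≈ ∣ val s - val t ∣
    r-on-bridge s t with total (val t) (val s)
    ... | inj₁ t≤s = trans (r-bridge-≤ s t t≤s) (sym (∣∣-nonNeg (0≤y-x t≤s)))
    ... | inj₂ s≤t = trans (r-sym (on e s) (on e t)) (trans (r-bridge-≤ t s s≤t)
                       (trans (sym (∣∣-nonNeg (0≤y-x s≤t))) (∣∣-swap (val t) (val s))))

  off-other : ∀ {i j} → i ≢ j → ∀ y → Off i (on j y)
  off-other {i} i≢j y t = Tent-off i t y i≢j

  off-vertex : ∀ i v → Off i (vertex v)
  off-vertex i v t = refl

  -- `Between` speaks of the points of the edge; this extracts its end vertex.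
  component-p : ∀ i {j b} → (∀ t → InComponent j b (on i t)) → InComponent j b (vertex (p i))
  component-p i h = InComponent-resp (return (start i refl)) (h (start-point i))

  component-q : ∀ i {j b} → (∀ t → InComponent j b (on i t)) → InComponent j b (vertex (q i))
  component-q i h = InComponent-resp (return (end i refl)) (h (end-point i))

-- The Arakelov-Green function in terms of resistance.

module Green (lem : ∀ {ℓ} → ExcludedMiddle ℓ) (R : RealField) (Γ : MetrizedGraph R)
             (volt : OnGraph.Point lem R Γ → OnGraph.Point lem R Γ → OnGraph.Point lem R Γ → RealField.ℝ R)
             (V : OnGraph.IsVoltage lem R Γ volt)
             (μ : OnGraph.SignedMeasure lem R Γ) (can : OnGraph.IsCanonical lem R Γ volt μ) where
  open RealField R hiding (zero)
  open OnGraph lem R Γ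
  open OrderedField lem R
  open Resistance lem R Γ volt V
  open Integration lem R Γ μ
  open IsCanonical can
  open SetoidReasoning setoid hiding (start)

  ∣½∣≤1 : ∣ ½ ∣ ≤ 1#
  ∣½∣≤1 = ≤-respˡ (sym (∣∣-nonNeg (<⇒≤ 0<½))) (≤-by (<⇒≤ 0<½) (sym ½+½≈1))
    where
    0<½ : 0# < ½
    0<½ = <-≤-trans (½-pos 0<1) (≤-reflexive (*-identityʳ ½))

  -- With c = 2τ, the inner integral is c - ½ r(x,y). Integrating over `x` replaces r by c and
  -- leaves the constant c - ½ c = τ, which the outer integral keeps; the difference is τ - ½
  -- r(x,y).
  green-resistance : ∀ {τ g} → IsTau volt μ τ → IsGreen volt μ g → ∀ x y → g x y ≈ τ - ½ * r x y
  green-resistance {τ} {g} (c , ∫r , τ≈) isGreen x y = trans (green x y) (lin₃ (jμ≈ x y) C≈ τ≈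
      (solve 6 (λ J C c h ρ τ → (J :- C) :- (τ :- h :* ρ) :=
         :1 :* (J :- (c :+ (:- h) :* ρ)) :+ (:- :1) :* (C :- (c :+ (:- h) :* c)) :+ (:- :1) :* (τ :- h :* c)) refl
        (jμ x y) C c ½ (r x y) τ))
    where
    open IsGreen isGreen renaming (k to kμ)
    ∣-½∣≤1 : ∣ - ½ ∣ ≤ 1#
    ∣-½∣≤1 = ≤-trans (∣∣-neg ½) ∣½∣≤1
    jμ≈ : ∀ x y → jμ x y ≈ c + - ½ * r x y
    jμ≈ x y = trans (integral-unique finiteVariation (inner x y)
        (integral-cong split refl (integral-+ (integral-+ (integral-scale ∣½∣≤1 (∫r x)) (integral-scale ∣½∣≤1 (∫r y)))
          (integral-const totalMass (- ½ * r x y)))))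
        (+-congʳ (double-half c))
      where
      split : ∀ z → (½ * volt z x x + ½ * volt z y y) + - ½ * r x y ≈ volt z x y
      split z = sym (trans (volt-r z x y)
        (solve 4 (λ h a b c → h :* ((a :+ b) :- c) := (h :* a :+ h :* b) :+ (:- h) :* c) refl
                  ½ (r x z) (r y z) (r x y)))
    kμ≈ : ∀ y → kμ y ≈ c + - ½ * c
    kμ≈ y = integral-unique finiteVariation (middle y)
      -- `IsTau` integrates `r y x` over `x`, the second argument, so the arguments are exchanged
      -- first.
      (integral-cong (λ x → trans (+-congˡ (*-congˡ (r-sym y x))) (sym (jμ≈ x y))) refl
        (integral-+ (integral-const totalMass c) (integral-scale ∣-½∣≤1 (∫r y))))
    C≈ : C ≈ c + - ½ * c
    C≈ = integral-unique finiteVariation outer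
      (integral-cong (λ y → sym (kμ≈ y)) refl (integral-const totalMass (c + - ½ * c)))

  ⁻¹-unique : ∀ {x y} → x ≉ 0# → x * y ≈ 1# → x ⁻¹ ≈ y
  ⁻¹-unique x≉0 e = *-cancelˡ x≉0 (trans (*-inverseʳ x≉0) (sym e))

  -- The expansion of `r-edge` in powers of the parameter. In the application `a` is the end point
  -- through which the bridge is left, and `d` the distance to it along the bridge.
  r-edge-quadratic : ∀ τ d e y {a} → Off e a →
    τ - ½ * (d + r a (on e y)) ≈
      τ + val y * val y * ((len e - r (vertex (p e)) (vertex (q e))) / (2# * (len e * len e)))
        - val y * ((len e - r (vertex (p e)) (vertex (q e)) + r a (vertex (q e)) - r a (vertex (p e))) / (2# * len e))
        - ½ * (d + r a (vertex (p e)))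
  r-edge-quadratic τ d e y {a} off = trans (+-congˡ (-‿cong (*-congˡ (+-congˡ (r-edge e y off)))))
    (trans (solve 9 (λ τ h d y i L A B D →
        τ :- h :* (d :+ ((:1 :- y :* i) :* A :+ (y :* i) :* B :+ (y :* i) :* (:1 :- y :* i) :* (L :- D))) :=
        ((τ :+ y :* y :* ((L :- D) :* (h :* (i :* i)))) :- y :* (((L :- D :+ B) :- A) :* (h :* i))) :- h :* (d :+ A)) refl
        τ ½ d (val y) i (len e) (r a P) (r a Q) (r P Q))
      -- The solver treats `L⁻¹ e` as an atom; the stated denominators are recovered from uniqueness
      -- of inverses.
      (+-congʳ (+-cong (+-congˡ (*-congˡ (*-congˡ (sym (⁻¹-unique (0<⇒≉0 2LL>0) 2LL⁻¹)))))
                       (-‿cong (*-congˡ (*-congˡ (sym (⁻¹-unique (0<⇒≉0 2L>0) 2L⁻¹))))))))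
    where
    open Potential lem R Γ using (L⁻¹; L*L⁻¹≈1)
    P = vertex (p e)
    Q = vertex (q e)
    i = L⁻¹ e
    2L>0 : 0# < 2# * len e
    2L>0 = *-pos 0<2 (0<len e)
    2LL>0 : 0# < 2# * (len e * len e)
    2LL>0 = *-pos 0<2 (*-pos (0<len e) (0<len e))
    2L⁻¹ : (2# * len e) * (½ * i) ≈ 1#
    2L⁻¹ = lin₂ ½+½≈1 (L*L⁻¹≈1 e) (solve 3 (λ h i L → ((:1 :+ :1) :* L) :* (h :* i) :- :1 :=
              (L :* i) :* ((h :+ h) :- :1) :+ :1 :* (L :* i :- :1)) refl ½ i (len e))
    2LL⁻¹ : (2# * (len e * len e)) * (½ * (i * i)) ≈ 1#
    2LL⁻¹ = lin₂ ½+½≈1 (L*L⁻¹≈1 e) (solve 3 (λ h i L → ((:1 :+ :1) :* (L :* L)) :* (h :* (i :* i)) :- :1 :=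
              (L :* i :* (L :* i)) :* ((h :+ h) :- :1) :+ (L :* i :+ :1) :* (L :* i :- :1)) refl ½ i (len e))

-- The formulas for bridges.

theorem4p4 :
  (lem : ∀ {ℓ} → ExcludedMiddle ℓ) (R : RealField) (Γ : MetrizedGraph R) →
  let open RealField R
      open OnGraph lem R Γ
      P : Fin #E → Point
      P e = vertex (p e)
      Q : Fin #E → Point
      Q e = vertex (q e)
      L : Fin #E → ℝ
      L = len
  in
  (volt : Point → Point → Point → ℝ) → IsVoltage volt →
  (μcan : SignedMeasure) → IsCanonical volt μcan →
  (τ : ℝ) → IsTau volt μcan τ →
  (g : Point → Point → ℝ) → IsGreen volt μcan g →
  let r : Point → Point → ℝ
      r = resistance volt
  in
  -- (1)
  (∀ e (x y : Segment R (L e)) → IsBridge e →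
    g (on e x) (on e y) ≈ τ - ½ * ∣ val x - val y ∣)
  ×
  -- (2)
  (∀ i j (x : Segment R (L i)) (y : Segment R (L j)) →
    i ≢ j → IsBridge i → IsBridge j →
    (Between i (p i) j (p j) →
      g (on i x) (on j y) ≈ τ - ½ * (val x + val y + r (P i) (P j)))
    ×
    (Between i (p i) j (q j) →
      g (on i x) (on j y) ≈ τ - ½ * (val x + L j - val y + r (P i) (Q j)))
    ×
    (Between i (q i) j (p j) →
      g (on i x) (on j y) ≈ τ - ½ * (L i - val x + val y + r (P j) (Q i)))
    ×
    (Between i (q i) j (q j) →
      g (on i x) (on j y) ≈
        τ - ½ * (L i - val x + L j - val y + r (Q i) (Q j))))
  ×
  -- (3), only the edge of x is a bridge
  (∀ i j (x : Segment R (L i)) (y : Segment R (L j)) →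
    IsBridge i → ¬ IsBridge j →
    (InComponent i (p i) (on j y) →
      g (on i x) (on j y) ≈
        τ + val y * val y * ((L j - r (P j) (Q j)) / (2# * (L j * L j)))
          - val y * ((L j - r (P j) (Q j) + r (P i) (Q j) - r (P i) (P j)) / (2# * L j))
          - ½ * (val x + r (P i) (P j)))
    ×
    (InComponent i (q i) (on j y) →
      g (on i x) (on j y) ≈
        τ + val y * val y * ((L j - r (P j) (Q j)) / (2# * (L j * L j)))
          - val y * ((L j - r (P j) (Q j) + r (Q i) (Q j) - r (Q i) (P j)) / (2# * L j))
          - ½ * (L i - val x + r (Q i) (P j))))
  ×
  -- (3) with the roles exchanged, only the edge of y is a bridge
  (∀ i j (x : Segment R (L i)) (y : Segment R (L j)) →
    ¬ IsBridge i → IsBridge j →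
    (InComponent j (p j) (on i x) →
      g (on i x) (on j y) ≈
        τ + val x * val x * ((L i - r (P i) (Q i)) / (2# * (L i * L i)))
          - val x * ((L i - r (P i) (Q i) + r (P j) (Q i) - r (P j) (P i)) / (2# * L i))
          - ½ * (val y + r (P j) (P i)))
    ×
    (InComponent j (q j) (on i x) →
      g (on i x) (on j y) ≈
        τ + val x * val x * ((L i - r (P i) (Q i)) / (2# * (L i * L i)))
          - val x * ((L i - r (P i) (Q i) + r (Q j) (Q i) - r (Q j) (P i)) / (2# * L i))
          - ½ * (L j - val y + r (Q j) (P i))))
theorem4p4 lem R Γ volt V μcan can τ isTau g isGreen =
    (λ e x y bridge → trans (g≈ (on e x) (on e y)) (via (r-on-bridge bridge x y)))
  , (λ i j x y i≢j bᵢ bⱼ →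
        -- The resistance is cut twice. By `jᵢ` the point `y` lies on the side of `p i`, which cuts
        -- at that vertex; `iⱼ`, specialised to the start of edge `i`, puts `p i` on the side of
        -- `p j`, which cuts at `p j`.
        (λ (jᵢ , iⱼ) → trans (g≈ (on i x) (on j y)) (via (trans
          (r-from-p bᵢ (off-other i≢j y) (jᵢ y) x)
          (add (trans (far-p bⱼ (component-p i iⱼ) y) (+-congˡ (r-sym _ _)))
               (solve 3 (λ x y r → x :+ (y :+ r) := x :+ y :+ r) refl (val x) (val y) _)))))
      , (λ (jᵢ , iⱼ) → trans (g≈ (on i x) (on j y)) (via (trans
          (r-from-p bᵢ (off-other i≢j y) (jᵢ y) x)
          (add (trans (far-q bⱼ (component-p i iⱼ) y) (+-congˡ (r-sym _ _)))
               (solve 4 (λ x l y r → x :+ ((l :- y) :+ r) := x :+ l :- y :+ r) refl (val x) (len j) (val y) _)))))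
      , (λ (jᵢ , iⱼ) → trans (g≈ (on i x) (on j y)) (via (trans
          (r-from-q bᵢ (off-other i≢j y) (jᵢ y) x)
          (add (far-p bⱼ (component-q i iⱼ) y)
               (solve 4 (λ l x y r → (l :- x) :+ (y :+ r) := l :- x :+ y :+ r) refl (len i) (val x) (val y) _)))))
      , (λ (jᵢ , iⱼ) → trans (g≈ (on i x) (on j y)) (via (trans
          (r-from-q bᵢ (off-other i≢j y) (jᵢ y) x)
          (add (trans (far-q bⱼ (component-q i iⱼ) y) (+-congˡ (r-sym _ _)))
               (solve 5 (λ k x l y r → (k :- x) :+ ((l :- y) :+ r) := k :- x :+ l :- y :+ r) refl
                 (len i) (val x) (len j) (val y) _))))))
  , (λ i j x y bᵢ ¬bⱼ →
        (λ y∈p → trans (g≈ (on i x) (on j y)) (trans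
          (via (r-from-p bᵢ (off-other (differ bᵢ ¬bⱼ) y) y∈p x))
          (r-edge-quadratic τ (val x) j y (off-vertex j (p i)))))
      , (λ y∈q → trans (g≈ (on i x) (on j y)) (trans
          (via (r-from-q bᵢ (off-other (differ bᵢ ¬bⱼ) y) y∈q x))
          (r-edge-quadratic τ (len i - val x) j y (off-vertex j (q i))))))
  , (λ i j x y ¬bᵢ bⱼ →
        (λ x∈p → trans (g≈ (on i x) (on j y)) (trans
          (via (trans (r-sym (on i x) (on j y)) (r-from-p bⱼ (off-other (differ bⱼ ¬bᵢ) x) x∈p y)))
          (r-edge-quadratic τ (val y) i x (off-vertex i (p j)))))
      , (λ x∈q → trans (g≈ (on i x) (on j y)) (trans
          (via (trans (r-sym (on i x) (on j y)) (r-from-q bⱼ (off-other (differ bⱼ ¬bᵢ) x) x∈q y)))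
          (r-edge-quadratic τ (len j - val y) i x (off-vertex i (q j))))))
  where
  open RealField R
  open OnGraph lem R Γ
  open OrderedField lem R using (solve; _:+_; _:-_; _:=_)
  open Resistance lem R Γ volt V
  open Bridges lem R Γ volt V
  open Green lem R Γ volt V μcan can

  g≈ : ∀ x y → g x y ≈ τ - ½ * r x y
  g≈ = green-resistance isTau isGreen

  via : ∀ {a b} → a ≈ b → τ - ½ * a ≈ τ - ½ * b
  via a≈b = +-congˡ (-‿cong (*-congˡ a≈b))

  add : ∀ {a b c d} → b ≈ c → a + c ≈ d → a + b ≈ d
  add b≈c = trans (+-congˡ b≈c)

  -- The second cut in case (2), after the point of the first bridge has been replaced by one of its
  -- end points.
  far-p : ∀ {j} → IsBridge j → ∀ {v} → InComponent j (p j) (vertex v) → ∀ y →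
          r (vertex v) (on j y) ≈ val y + r (vertex (p j)) (vertex v)
  far-p {j} bridge {v} v∈p y = trans (r-sym _ _) (r-from-p bridge (off-vertex j v) v∈p y)

  far-q : ∀ {j} → IsBridge j → ∀ {v} → InComponent j (q j) (vertex v) → ∀ y →
          r (vertex v) (on j y) ≈ (len j - val y) + r (vertex (q j)) (vertex v)
  far-q {j} bridge {v} v∈q y = trans (r-sym _ _) (r-from-q bridge (off-vertex j v) v∈q y)

  differ : ∀ {i j} → IsBridge i → ¬ IsBridge j → i ≢ j
  differ bᵢ ¬bⱼ ≡.refl = ¬bⱼ bᵢ
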